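{- For each positive integer $n$, with $N=\{1,\dots,n\}$, let $$K=K_n=\{0,1\}^n\cap\Big\{x\in[0,1]^n : \sum_{r\in R}x_r+\sum_{r\in N\setminus R}(1-x_r)\ge\tfrac12\ \text{ for all } R\subseteq N\Big\}.$$ Then the SoS rank $\rho(K)$ satisfies $\Omega(\sqrt n)\le\rho(K)\le n-\Omega(n^{1/3})$; that is, there exist constants $c_1,c_2>0$ and $n_0\in\mathbb{N}$ such that for all $n\ge n_0$, $$c_1\sqrt n\le\rho(K_n)\le n-c_2\,n^{1/3}.$$
   Context: For $I\subseteq N$, $x_I\in\{0,1\}^n$ is the point with $x_i=1$ for $i\in I$ and $x_i=0$ for $i\in N\setminus I$. For an integer $q$, $\mathcal{P}_q(N)$ is the collection of subsets of $N$ of size at most $q$. For $I\subseteq N$, the zeta vector $Z_I\in\mathbb{R}^{\mathcal{P}_q(N)}$ is the $0/1$ vector whose $J$-th entry ($|J|\le q$) equals $1$ if and only if $J\subseteq I$. For a set $P=\{x\in\{0,1\}^n : g_\ell(x)\ge0,\ \ell=1,\dots,p\}$ given by linear constraints $g_\ell$, the $t$-th round SoS relaxation $\mathrm{SoS}_t(P)$ is the set of all real vectors $(y_I^N)_{I\subseteq N}$ satisfying: (i) $\sum_{I\subseteq N}y_I^N=1$; (ii) $\sum_{I\subseteq N}y_I^N Z_IZ_I^\top\succeq0$ with $Z_I\in\mathbb{R}^{\mathcal{P}_{t+1}(N)}$; (iii) for every $\ell$, $\sum_{I\subseteq N}g_\ell(x_I)\,y_I^N Z_IZ_I^\top\succeq0$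 with $Z_I\in\mathbb{R}^{\mathcal{P}_t(N)}$. For $K$, the constraints are $g_R(x)=\sum_{r\in R}x_r+\sum_{r\in N\setminus R}(1-x_r)-\frac12\ge0$, one for each $R\subseteq N$. The projection of $y^N\in\mathrm{SoS}_t(P)$ to $\mathbb{R}^n$ is given by $x_i=\sum_{I\subseteq N,\ i\in I}y_I^N$ for $i=1,\dots,n$. The SoS rank $\rho(P)$ is the smallest $t$ such that the projection of $\mathrm{SoS}_t(P)$ equals the convex hull of the integral points of $P$. (Since $K$ contains no integral points, $\rho(K)$ is the smallest $t$ with $\mathrm{SoS}_t(K)=\emptyset$.) -}

module Defs where

open import Algebra.Bundles.Raw using (RawMonoid)
open import Data.Fin using (Fin)
open import Data.Fin.Subset using (Subset; inside; outside; _∈_; _⊆_; ∁; ∣_∣)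
open import Data.Fin.Subset.Properties using (_∈?_; _⊆?_)
open import Data.Integer as ℤ using (+_)
import Data.Integer.Properties as ℤ
open import Data.Nat as ℕ using (ℕ; zero; suc; NonZero; s≤s; z≤n)
import Data.Nat.Properties as ℕ
import Data.Nat.Tactic.RingSolver as ℕSolver
open import Data.Product using (Σ; ∃; _×_; _,_; proj₁; proj₂)
open import Data.Rational as ℚ using (ℚ; 0ℚ; 1ℚ; ½)
import Data.Rational.Properties as ℚ
open import Data.Rational.Solver using (module +-*-Solver)
open import Data.Rational.Unnormalised as ℚᵘ using (ℚᵘ; mkℚᵘ)
import Data.Rational.Unnormalised.Properties as ℚᵘ
open import Data.Sum using (_⊎_; inj₁; inj₂)
open import Data.Vec using ([]; _∷_)
open import Function using (_∘_)
open import Level using (0ℓ)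
open import Relation.Binary.PropositionalEquality
open import Relation.Nullary using (Dec; yes; no)
open import Relation.Unary using (Pred; _≐_)

-- Real numbers are Cauchy sequences of rationals, up to _≈_. Proofs of Cauchyness
-- are abstract so that comparing reals never unfolds them.

IsCauchy : (ℕ → ℚ) → Set
IsCauchy s = ∀ ε → 0ℚ ℚ.< ε → ∃ λ N → ∀ m n → N ℕ.≤ m → N ℕ.≤ n →
             ℚ.∣ s m ℚ.- s n ∣ ℚ.< ε

record ℝ : Set where
  constructor mkℝ
  field
    seq    : ℕ → ℚ
    cauchy : IsCauchy seq

open ℝ public

infix 4 _≤_ _<_ _≈_

_≤_ : ℝ → ℝ → Set
x ≤ y = ∀ ε → 0ℚ ℚ.< ε → ∃ λ N → ∀ n → N ℕ.≤ n → seq x n ℚ.≤ seq y n ℚ.+ ε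

_<_ : ℝ → ℝ → Set
x < y = ∃ λ ε → 0ℚ ℚ.< ε × ∃ λ N → ∀ n → N ℕ.≤ n → seq x n ℚ.+ ε ℚ.≤ seq y n

_≈_ : ℝ → ℝ → Set
x ≈ y = x ≤ y × y ≤ x

abstract
  abs<-of : ∀ p ε → p ℚ.< ε → ℚ.- p ℚ.< ε → ℚ.∣ p ∣ ℚ.< ε
  abs<-of p ε p<ε -p<ε with ℚ.∣p∣≡p∨∣p∣≡-p p
  ... | inj₁ e = subst (ℚ._< ε) (sym e) p<ε
  ... | inj₂ e = subst (ℚ._< ε) (sym e) -p<ε

  half>0 : ∀ ε → 0ℚ ℚ.< ε → 0ℚ ℚ.< ½ ℚ.* ε
  half>0 ε 0<ε = subst (ℚ._< ½ ℚ.* ε) (ℚ.*-zeroʳ ½) (ℚ.*-monoʳ-<-pos ½ 0<ε)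

  half+half : ∀ ε → ½ ℚ.* ε ℚ.+ ½ ℚ.* ε ≡ ε
  half+half ε = trans (sym (ℚ.*-distribʳ-+ ε ½ ½)) (ℚ.*-identityˡ ε)

  const-cauchy : ∀ q → IsCauchy (λ _ → q)
  const-cauchy q ε 0<ε =
    0 , λ _ _ _ _ → subst (ℚ._< ε) (cong ℚ.∣_∣ (sym (ℚ.+-inverseʳ q))) 0<ε

  +-cauchy : ∀ {s t} → IsCauchy s → IsCauchy t → IsCauchy (λ n → s n ℚ.+ t n)
  +-cauchy {s} {t} cs ct ε 0<ε
    with cs (½ ℚ.* ε) (half>0 ε 0<ε) | ct (½ ℚ.* ε) (half>0 ε 0<ε)
  ... | M , hM | N , hN = M ℕ.+ N , λ m n lm ln → begin-strict
    ℚ.∣ (s m ℚ.+ t m) ℚ.- (s n ℚ.+ t n) ∣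
      ≡⟨ cong ℚ.∣_∣ (solve 4 (λ a b c d → (a :+ b) :- (c :+ d) := (a :- c) :+ (b :- d))
                      refl (s m) (t m) (s n) (t n)) ⟩
    ℚ.∣ (s m ℚ.- s n) ℚ.+ (t m ℚ.- t n) ∣
      ≤⟨ ℚ.∣p+q∣≤∣p∣+∣q∣ (s m ℚ.- s n) (t m ℚ.- t n) ⟩
    ℚ.∣ s m ℚ.- s n ∣ ℚ.+ ℚ.∣ t m ℚ.- t n ∣
      <⟨ ℚ.+-mono-< (hM m n (ℕ.≤-trans (ℕ.m≤m+n M N) lm) (ℕ.≤-trans (ℕ.m≤m+n M N) ln))
                    (hN m n (ℕ.≤-trans (ℕ.m≤n+m N M) lm) (ℕ.≤-trans (ℕ.m≤n+m N M) ln)) ⟩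
    ½ ℚ.* ε ℚ.+ ½ ℚ.* ε ≡⟨ half+half ε ⟩
    ε ∎
    where
    open ℚ.≤-Reasoning
    open +-*-Solver

  neg-cauchy : ∀ {s} → IsCauchy s → IsCauchy (λ n → ℚ.- s n)
  neg-cauchy {s} cs ε 0<ε with cs ε 0<ε
  ... | N , h = N , λ m n lm ln → subst (ℚ._< ε) (sym (eq m n)) (h m n lm ln)
    where
    open +-*-Solver
    eq : ∀ m n → ℚ.∣ ℚ.- s m ℚ.- ℚ.- s n ∣ ≡ ℚ.∣ s m ℚ.- s n ∣
    eq m n = trans
      (cong ℚ.∣_∣ (solve 2 (λ a b → :- a :- (:- b) := :- (a :- b)) refl (s m) (s n)))
      (ℚ.∣-p∣≡∣p∣ (s m ℚ.- s n))

  tail-bound : ∀ {s} → IsCauchy s →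
               ∃ λ B → 0ℚ ℚ.≤ B × ∃ λ N → ∀ n → N ℕ.≤ n → ℚ.∣ s n ∣ ℚ.≤ B
  tail-bound {s} cs with cs 1ℚ (ℚ.positive⁻¹ 1ℚ)
  ... | N , h = 1ℚ ℚ.+ ℚ.∣ s N ∣
              , ℚ.+-mono-≤ (ℚ.nonNegative⁻¹ 1ℚ) (ℚ.0≤∣p∣ (s N))
              , N , λ n ln → begin
    ℚ.∣ s n ∣
      ≡⟨ cong ℚ.∣_∣ (solve 2 (λ a b → a := (a :- b) :+ b) refl (s n) (s N)) ⟩
    ℚ.∣ (s n ℚ.- s N) ℚ.+ s N ∣
      ≤⟨ ℚ.∣p+q∣≤∣p∣+∣q∣ (s n ℚ.- s N) (s N) ⟩
    ℚ.∣ s n ℚ.- s N ∣ ℚ.+ ℚ.∣ s N ∣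
      ≤⟨ ℚ.+-monoˡ-≤ ℚ.∣ s N ∣ (ℚ.<⇒≤ (h n N ln ℕ.≤-refl)) ⟩
    1ℚ ℚ.+ ℚ.∣ s N ∣ ∎
    where
    open ℚ.≤-Reasoning
    open +-*-Solver

  divide : ∀ D ε → .{{ℚ.Positive D}} → 0ℚ ℚ.< ε → ∃ λ δ → 0ℚ ℚ.< δ × D ℚ.* δ ≡ ε
  divide D ε 0<ε = 1/D ℚ.* ε
    , subst (ℚ._< 1/D ℚ.* ε) (ℚ.*-zeroʳ 1/D)
        (ℚ.*-monoʳ-<-pos 1/D {{ℚ.1/pos⇒pos D}} 0<ε)
    , trans (sym (ℚ.*-assoc D 1/D ε))
        (trans (cong (ℚ._* ε) (ℚ.*-inverseʳ D {{ℚ.pos⇒nonZero D}})) (ℚ.*-identityˡ ε))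
    where
    1/D : ℚ
    1/D = ℚ.1/_ D {{ℚ.pos⇒nonZero D}}

  ∣p*q∣<D*δ : ∀ D δ → .{{ℚ.Positive D}} → ∀ p q →
              ℚ.∣ p ∣ ℚ.≤ D → ℚ.∣ q ∣ ℚ.< δ → ℚ.∣ p ℚ.* q ∣ ℚ.< D ℚ.* δ
  ∣p*q∣<D*δ D δ p q p≤D q<δ = begin-strict
    ℚ.∣ p ℚ.* q ∣       ≡⟨ ℚ.∣p*q∣≡∣p∣*∣q∣ p q ⟩
    ℚ.∣ p ∣ ℚ.* ℚ.∣ q ∣ ≤⟨ ℚ.*-monoʳ-≤-nonNeg ℚ.∣ q ∣ {{ℚ.∣-∣-nonNeg q}} p≤D ⟩
    D ℚ.* ℚ.∣ q ∣       <⟨ ℚ.*-monoʳ-<-pos D q<δ ⟩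
    D ℚ.* δ             ∎
    where open ℚ.≤-Reasoning

  common-bound : ∀ {s t} → IsCauchy s → IsCauchy t →
                 ∃ λ D → ℚ.Positive D × ∃ λ N → ∀ n → N ℕ.≤ n →
                   ℚ.∣ s n ∣ ℚ.≤ D × ℚ.∣ t n ∣ ℚ.≤ D
  common-bound {s} {t} cs ct = combine (tail-bound {s} cs) (tail-bound {t} ct)
    where
    combine : (∃ λ B → 0ℚ ℚ.≤ B × ∃ λ N → ∀ n → N ℕ.≤ n → ℚ.∣ s n ∣ ℚ.≤ B) →
              (∃ λ C → 0ℚ ℚ.≤ C × ∃ λ N → ∀ n → N ℕ.≤ n → ℚ.∣ t n ∣ ℚ.≤ C) →
              ∃ λ D → ℚ.Positive D × ∃ λ N → ∀ n → N ℕ.≤ n →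
                ℚ.∣ s n ∣ ℚ.≤ D × ℚ.∣ t n ∣ ℚ.≤ D
    combine (B , 0≤B , M , hB) (C , 0≤C , N , hC) =
      1ℚ ℚ.+ (B ℚ.+ C)
      , ℚ.positive (ℚ.+-mono-<-≤ (ℚ.positive⁻¹ 1ℚ) (ℚ.+-mono-≤ 0≤B 0≤C))
      , M ℕ.+ N
      , λ n l → ℚ.≤-trans (hB n (ℕ.≤-trans (ℕ.m≤m+n M N) l)) B≤
              , ℚ.≤-trans (hC n (ℕ.≤-trans (ℕ.m≤n+m N M) l)) C≤
      where
      B≤ : B ℚ.≤ 1ℚ ℚ.+ (B ℚ.+ C)
      B≤ = subst (ℚ._≤ 1ℚ ℚ.+ (B ℚ.+ C)) (trans (ℚ.+-identityˡ _) (ℚ.+-identityʳ B))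
             (ℚ.+-mono-≤ (ℚ.nonNegative⁻¹ 1ℚ) (ℚ.+-monoʳ-≤ B 0≤C))
      C≤ : C ℚ.≤ 1ℚ ℚ.+ (B ℚ.+ C)
      C≤ = subst (ℚ._≤ 1ℚ ℚ.+ (B ℚ.+ C)) (trans (ℚ.+-identityˡ _) (ℚ.+-identityˡ C))
             (ℚ.+-mono-≤ (ℚ.nonNegative⁻¹ 1ℚ) (ℚ.+-monoˡ-≤ C 0≤B))

  *-difference : ∀ a b c d → a ℚ.* b ℚ.- c ℚ.* d ≡ a ℚ.* (b ℚ.- d) ℚ.+ d ℚ.* (a ℚ.- c)
  *-difference = solve 4 (λ a b c d →
      a :* b :- c :* d := a :* (b :- d) :+ d :* (a :- c)) refl
    where open +-*-Solver

  *-close : ∀ D δ ε → .{{ℚ.Positive D}} → D ℚ.* δ ≡ ½ ℚ.* ε → ∀ a b c d →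
            ℚ.∣ a ∣ ℚ.≤ D → ℚ.∣ d ∣ ℚ.≤ D →
            ℚ.∣ b ℚ.- d ∣ ℚ.< δ → ℚ.∣ a ℚ.- c ∣ ℚ.< δ →
            ℚ.∣ a ℚ.* b ℚ.- c ℚ.* d ∣ ℚ.< ε
  *-close D δ ε Dδ a b c d a≤D d≤D b-d<δ a-c<δ = begin-strict
    ℚ.∣ a ℚ.* b ℚ.- c ℚ.* d ∣
      ≡⟨ cong ℚ.∣_∣ (*-difference a b c d) ⟩
    ℚ.∣ a ℚ.* (b ℚ.- d) ℚ.+ d ℚ.* (a ℚ.- c) ∣
      ≤⟨ ℚ.∣p+q∣≤∣p∣+∣q∣ (a ℚ.* (b ℚ.- d)) (d ℚ.* (a ℚ.- c)) ⟩
    ℚ.∣ a ℚ.* (b ℚ.- d) ∣ ℚ.+ ℚ.∣ d ℚ.* (a ℚ.- c) ∣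
      <⟨ ℚ.+-mono-< (∣p*q∣<D*δ D δ a (b ℚ.- d) a≤D b-d<δ)
                    (∣p*q∣<D*δ D δ d (a ℚ.- c) d≤D a-c<δ) ⟩
    D ℚ.* δ ℚ.+ D ℚ.* δ ≡⟨ cong₂ ℚ._+_ Dδ Dδ ⟩
    ½ ℚ.* ε ℚ.+ ½ ℚ.* ε ≡⟨ half+half ε ⟩
    ε                   ∎
    where open ℚ.≤-Reasoning

  *-cauchy : ∀ {s t} → IsCauchy s → IsCauchy t → IsCauchy (λ n → s n ℚ.* t n)
  *-cauchy {s} {t} cs ct ε 0<ε = bounded (common-bound {s} {t} cs ct)
    where
    module _ (D : ℚ) (D>0 : ℚ.Positive D) (M : ℕ)
             (h : ∀ n → M ℕ.≤ n → ℚ.∣ s n ∣ ℚ.≤ D × ℚ.∣ t n ∣ ℚ.≤ D) where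
      close : (∃ λ δ → 0ℚ ℚ.< δ × D ℚ.* δ ≡ ½ ℚ.* ε) →
              ∃ λ N → ∀ m n → N ℕ.≤ m → N ℕ.≤ n →
                ℚ.∣ s m ℚ.* t m ℚ.- s n ℚ.* t n ∣ ℚ.< ε
      close (δ , 0<δ , Dδ) = M ℕ.+ (N₁ ℕ.+ N₂) , λ m n lm ln →
        *-close D δ ε {{D>0}} Dδ (s m) (t m) (s n) (t n)
          (proj₁ (h m (ℕ.≤-trans leM lm))) (proj₂ (h n (ℕ.≤-trans leM ln)))
          (proj₂ (ct δ 0<δ) m n (ℕ.≤-trans leN₂ lm) (ℕ.≤-trans leN₂ ln))
          (proj₂ (cs δ 0<δ) m n (ℕ.≤-trans leN₁ lm) (ℕ.≤-trans leN₁ ln))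
        where
        N₁ = proj₁ (cs δ 0<δ)
        N₂ = proj₁ (ct δ 0<δ)
        leM : M ℕ.≤ M ℕ.+ (N₁ ℕ.+ N₂)
        leM = ℕ.m≤m+n M (N₁ ℕ.+ N₂)
        leN₁ : N₁ ℕ.≤ M ℕ.+ (N₁ ℕ.+ N₂)
        leN₁ = ℕ.≤-trans (ℕ.m≤m+n N₁ N₂) (ℕ.m≤n+m (N₁ ℕ.+ N₂) M)
        leN₂ : N₂ ℕ.≤ M ℕ.+ (N₁ ℕ.+ N₂)
        leN₂ = ℕ.≤-trans (ℕ.m≤n+m N₂ N₁) (ℕ.m≤n+m (N₁ ℕ.+ N₂) M)
    bounded : (∃ λ D → ℚ.Positive D × ∃ λ M → ∀ n → M ℕ.≤ n →
                 ℚ.∣ s n ∣ ℚ.≤ D × ℚ.∣ t n ∣ ℚ.≤ D) →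
              ∃ λ N → ∀ m n → N ℕ.≤ m → N ℕ.≤ n →
                ℚ.∣ s m ℚ.* t m ℚ.- s n ℚ.* t n ∣ ℚ.< ε
    bounded (D , D>0 , M , h) =
      close D D>0 M h (divide D (½ ℚ.* ε) {{D>0}} (half>0 ε 0<ε))

infixl 6 _+_ _-_
infixl 7 _*_
infix  8 -_

fromℚ : ℚ → ℝ
fromℚ q = mkℝ (λ _ → q) (const-cauchy q)

fromℕ : ℕ → ℝ
fromℕ n = fromℚ ((+ n) ℚ./ 1)

0ℝ 1ℝ ½ℝ : ℝ
0ℝ = fromℚ 0ℚ
1ℝ = fromℚ 1ℚ
½ℝ = fromℚ ½

_+_ : ℝ → ℝ → ℝ
x + y = mkℝ (λ n → seq x n ℚ.+ seq y n) (+-cauchy {seq x} {seq y} (cauchy x) (cauchy y))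

-_ : ℝ → ℝ
- x = mkℝ (λ n → ℚ.- seq x n) (neg-cauchy {seq x} (cauchy x))

_-_ : ℝ → ℝ → ℝ
x - y = x + (- y)

_*_ : ℝ → ℝ → ℝ
x * y = mkℝ (λ n → seq x n ℚ.* seq y n) (*-cauchy {seq x} {seq y} (cauchy x) (cauchy y))

+-0-rawMonoid : RawMonoid 0ℓ 0ℓ
+-0-rawMonoid = record { Carrier = ℝ ; _≈_ = _≈_ ; _∙_ = _+_ ; ε = 0ℝ }

open import Algebra.Definitions.RawMonoid +-0-rawMonoid public using (sum)

-- iroot k N is the largest a with a ^ k ≤ N.
iroot : ℕ → ℕ → ℕ
iroot k zero = 0
iroot k (suc N) with suc (iroot k N) ℕ.^ k ℕ.≤? suc N
... | yes _ = suc (iroot k N)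
... | no  _ = iroot k N

iroot-spec : ∀ k .{{_ : NonZero k}} N →
             iroot k N ℕ.^ k ℕ.≤ N × N ℕ.< suc (iroot k N) ℕ.^ k
iroot-spec k@(suc _) zero = z≤n , subst (1 ℕ.≤_) (sym (ℕ.^-zeroˡ k)) ℕ.≤-refl
iroot-spec k (suc N) with suc (iroot k N) ℕ.^ k ℕ.≤? suc N | iroot-spec k N
... | yes p | _ , u = p , ℕ.≤-<-trans u (ℕ.^-monoˡ-< k (ℕ.n<1+n (suc (iroot k N))))
... | no ¬p | l , _ = ℕ.m≤n⇒m≤1+n l , ℕ.≰⇒> ¬p

rootSeq : ℕ → ℕ → ℕ → ℚ
rootSeq k n m = (+ iroot k (n ℕ.* suc m ℕ.^ k)) ℚ./ suc m

abstract
  /-mono : ∀ a m b p → a ℕ.* suc p ℕ.≤ b ℕ.* suc m →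
           (+ a) ℚ./ suc m ℚ.≤ (+ b) ℚ./ suc p
  /-mono a m b p h = ℚ.toℚᵘ-cancel-≤ (begin
    ℚ.toℚᵘ ((+ a) ℚ./ suc m) ≃⟨ ℚ.toℚᵘ-fromℚᵘ (mkℚᵘ (+ a) m) ⟩
    mkℚᵘ (+ a) m             ≤⟨ ℚᵘ.*≤* (subst₂ ℤ._≤_ (ℤ.pos-* a (suc p)) (ℤ.pos-* b (suc m)) (ℤ.+≤+ h)) ⟩
    mkℚᵘ (+ b) p             ≃⟨ ℚ.toℚᵘ-fromℚᵘ (mkℚᵘ (+ b) p) ⟨
    ℚ.toℚᵘ ((+ b) ℚ./ suc p) ∎)
    where open ℚᵘ.≤-Reasoning

  suc-/ : ∀ b p → (+ suc b) ℚ./ suc p ≡ (+ b) ℚ./ suc p ℚ.+ (+ 1) ℚ./ suc p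
  suc-/ b p = ℚ.toℚᵘ-injective (begin-equality
    ℚ.toℚᵘ ((+ suc b) ℚ./ suc p) ≃⟨ ℚ.toℚᵘ-fromℚᵘ (mkℚᵘ (+ suc b) p) ⟩
    mkℚᵘ (+ suc b) p             ≃⟨ ℚᵘ.*≡* eq ⟩
    mkℚᵘ (+ b) p ℚᵘ.+ mkℚᵘ (+ 1) p
      ≃⟨ ℚᵘ.+-cong (ℚ.toℚᵘ-fromℚᵘ (mkℚᵘ (+ b) p)) (ℚ.toℚᵘ-fromℚᵘ (mkℚᵘ (+ 1) p)) ⟨
    ℚ.toℚᵘ ((+ b) ℚ./ suc p) ℚᵘ.+ ℚ.toℚᵘ ((+ 1) ℚ./ suc p)
      ≃⟨ ℚ.toℚᵘ-homo-+ ((+ b) ℚ./ suc p) ((+ 1) ℚ./ suc p) ⟨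
    ℚ.toℚᵘ ((+ b) ℚ./ suc p ℚ.+ (+ 1) ℚ./ suc p) ∎)
    where
    open ℚᵘ.≤-Reasoning
    P : ℤ.ℤ
    P = + suc p
    eq : + suc b ℤ.* (+ suc p ℤ.* + suc p) ≡ (+ b ℤ.* + suc p ℤ.+ + 1 ℤ.* + suc p) ℤ.* + suc p
    eq = trans (sym (ℤ.*-assoc (+ suc b) P P)) (cong (ℤ._* P)
           (trans (cong (ℤ._* P) (cong +_ (ℕ.+-comm 1 b))) (ℤ.*-distribʳ-+ P (+ b) (+ 1))))

  ^-distribʳ-* : ∀ k a b → (a ℕ.* b) ℕ.^ k ≡ a ℕ.^ k ℕ.* b ℕ.^ k
  ^-distribʳ-* zero    a b = refl
  ^-distribʳ-* (suc k) a b = trans (cong (a ℕ.* b ℕ.*_) (^-distribʳ-* k a b))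
                                   (ℕ.[m*n]*[o*p]≡[m*o]*[n*p] a b (a ℕ.^ k) (b ℕ.^ k))

  root-step : ∀ k .{{_ : NonZero k}} n m p →
              rootSeq k n m ℚ.≤ rootSeq k n p ℚ.+ (+ 1) ℚ./ suc p
  root-step k n m p = subst (rootSeq k n m ℚ.≤_) (suc-/ b p)
    (/-mono a m (suc b) p (ℕ.≮⇒≥ λ lt → ℕ.<-irrefl refl (begin-strict
      (a ℕ.* suc p) ℕ.^ k                 ≡⟨ ^-distribʳ-* k a (suc p) ⟩
      a ℕ.^ k ℕ.* suc p ℕ.^ k             ≤⟨ ℕ.*-monoˡ-≤ (suc p ℕ.^ k) (proj₁ (iroot-spec k (n ℕ.* suc m ℕ.^ k))) ⟩
      n ℕ.* suc m ℕ.^ k ℕ.* suc p ℕ.^ k   ≡⟨ swap n (suc m ℕ.^ k) (suc p ℕ.^ k) ⟩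
      n ℕ.* suc p ℕ.^ k ℕ.* suc m ℕ.^ k   ≤⟨ ℕ.*-monoˡ-≤ (suc m ℕ.^ k) (ℕ.<⇒≤ (proj₂ (iroot-spec k (n ℕ.* suc p ℕ.^ k)))) ⟩
      suc b ℕ.^ k ℕ.* suc m ℕ.^ k         ≡⟨ ^-distribʳ-* k (suc b) (suc m) ⟨
      (suc b ℕ.* suc m) ℕ.^ k             <⟨ ℕ.^-monoˡ-< k lt ⟩
      (a ℕ.* suc p) ℕ.^ k                 ∎)))
    where
    open ℕ.≤-Reasoning
    a : ℕ
    a = iroot k (n ℕ.* suc m ℕ.^ k)
    b : ℕ
    b = iroot k (n ℕ.* suc p ℕ.^ k)
    swap : ∀ x y z → x ℕ.* y ℕ.* z ≡ x ℕ.* z ℕ.* y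
    swap = ℕSolver.solve-∀

  archimedean : ∀ ε → 0ℚ ℚ.< ε → ∃ λ N → ∀ m → N ℕ.≤ m → (+ 1) ℚ./ suc m ℚ.< ε
  archimedean ε@(ℚ.mkℚ (+ zero) _ _) (ℚ.*<* (ℤ.+<+ ()))
  archimedean ε@(ℚ.mkℚ (ℤ.-[1+ _ ]) _ _) (ℚ.*<* ())
  archimedean ε@(ℚ.mkℚ (+ suc a) d _) _ = suc d , λ m l → ℚ.toℚᵘ-cancel-<
    (ℚᵘ.<-respˡ-≃ (ℚᵘ.≃-sym (ℚ.toℚᵘ-fromℚᵘ (mkℚᵘ (+ 1) m)))
      (ℚᵘ.*<* (subst₂ ℤ._<_ (ℤ.pos-* 1 (suc d)) (ℤ.pos-* (suc a) (suc m))
        (ℤ.+<+ (subst (ℕ._< suc a ℕ.* suc m) (sym (ℕ.*-identityˡ (suc d)))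
          (ℕ.<-≤-trans (s≤s l) (ℕ.m≤n*m (suc m) (suc a))))))))

  root-cauchy : ∀ k .{{_ : NonZero k}} n → IsCauchy (rootSeq k n)
  root-cauchy k n ε 0<ε with archimedean ε 0<ε
  ... | N , h = N , λ m p lm lp → abs<-of (r m ℚ.- r p) ε (diff m p lp)
                      (subst (ℚ._< ε) (swap-minus (r p) (r m)) (diff p m lm))
    where
    r : ℕ → ℚ
    r = rootSeq k n
    cancel : ∀ a b → (a ℚ.+ b) ℚ.- a ≡ b
    cancel = solve 2 (λ a b → (a :+ b) :- a := b) refl
      where open +-*-Solver
    swap-minus : ∀ a b → a ℚ.- b ≡ ℚ.- (b ℚ.- a)
    swap-minus = solve 2 (λ a b → a :- b := :- (b :- a)) refl
      where open +-*-Solver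
    diff : ∀ m p → N ℕ.≤ p → rootSeq k n m ℚ.- rootSeq k n p ℚ.< ε
    diff m p lp = ℚ.≤-<-trans
      (subst (r m ℚ.- r p ℚ.≤_) (cancel (r p) ((+ 1) ℚ./ suc p))
        (ℚ.+-monoˡ-≤ (ℚ.- r p) (root-step k n m p)))
      (h p lp)

-- The real k-th root of n, as the limit of ⌊ n^(1/k) · (m + 1) ⌋ / (m + 1).
root : (k : ℕ) .{{_ : NonZero k}} → ℕ → ℝ
root k n = mkℝ (rootSeq k n) (root-cauchy k n)

when : ∀ {P : Set} → Dec P → (P → ℝ) → ℝ
when (yes p) f = f p
when (no _)  _ = 0ℝ

-- Sum over all subsets of Fin n.
∑⊆ : ∀ {n} → (Subset n → ℝ) → ℝ
∑⊆ {zero}  f = f []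
∑⊆ {suc n} f = ∑⊆ (f ∘ (outside ∷_)) + ∑⊆ (f ∘ (inside ∷_))

𝒫 : ℕ → ℕ → Set
𝒫 q n = Σ (Subset n) λ J → ∣ J ∣ ℕ.≤ q

∑𝒫 : ∀ q n → (𝒫 q n → ℝ) → ℝ
∑𝒫 q n f = ∑⊆ λ J → when (∣ J ∣ ℕ.≤? q) λ ∣J∣≤q → f (J , ∣J∣≤q)

Matrix : ℕ → ℕ → Set
Matrix q n = 𝒫 q n → 𝒫 q n → ℝ

record PSD {q n} (M : Matrix q n) : Set where
  field
    symmetric   : ∀ J J′ → M J J′ ≈ M J′ J
    nonnegative : ∀ (v : 𝒫 q n → ℝ) →
                  0ℝ ≤ ∑𝒫 q n λ J → ∑𝒫 q n λ J′ → v J * M J J′ * v J′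

Point : ℕ → Set
Point n = Fin n → ℝ

-- The 0/1 point x_I.
point : ∀ {n} → Subset n → Point n
point I i = when (i ∈? I) λ _ → 1ℝ

zeta : ∀ {q n} → Subset n → 𝒫 q n → ℝ
zeta I (J , _) = when (J ⊆? I) λ _ → 1ℝ

-- ∑_I w_I Z_I Z_Iᵀ, with Z_I indexed by 𝒫 q n.
zetaMatrix : ∀ q {n} → (Subset n → ℝ) → Matrix q n
zetaMatrix q w J J′ = ∑⊆ λ I → w I * (zeta I J * zeta I J′)

-- A family of constraints g ℓ x ≥ 0, ℓ : L. Linearity of the g ℓ plays no role
-- in the definitions below.
module _ {n : ℕ} {L : Set} (g : L → Point n → ℝ) where

  record SoS (t : ℕ) (y : Subset n → ℝ) : Set where
    field
      normalised    : ∑⊆ y ≈ 1ℝ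
      psd           : PSD (zetaMatrix (suc t) y)
      psdConstraint : ∀ ℓ → PSD (zetaMatrix t λ I → g ℓ (point I) * y I)

  Projection : ℕ → Pred (Point n) 0ℓ
  Projection t x = ∃ λ y → SoS t y × (∀ i → x i ≈ ∑⊆ λ I → when (i ∈? I) λ _ → y I)

  Feasible : Pred (Point n) 0ℓ
  Feasible x = (∀ i → x i ≈ 0ℝ ⊎ x i ≈ 1ℝ) × (∀ ℓ → 0ℝ ≤ g ℓ x)

ConvexHull : ∀ {n} → Pred (Point n) 0ℓ → Pred (Point n) 0ℓ
ConvexHull {n} S x =
  ∃ λ m → Σ (Fin m → Point n) λ p → Σ (Fin m → ℝ) λ c →
    (∀ j → S (p j)) × (∀ j → 0ℝ ≤ c j) × sum c ≈ 1ℝ ×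
    (∀ i → x i ≈ sum λ j → c j * p j i)

module _ {n : ℕ} {L : Set} (g : L → Point n → ℝ) where

  Exact : ℕ → Set
  Exact t = Projection g t ≐ ConvexHull (Feasible g)

  record IsSoSRank (ρ : ℕ) : Set where
    field
      exact : Exact ρ
      least : ∀ t → Exact t → ρ ℕ.≤ t

-- The constraints g_R defining K_n; K_n itself is Feasible (gK n).
gK : ∀ n → Subset n → Point n → ℝ
gK n R x = sum (λ r → when (r ∈? R) λ _ → x r)
         + sum (λ r → when (r ∈? ∁ R) λ _ → 1ℝ - x r)
         - ½ℝ

{-# OPTIONS --safe #-}

-- The lower bound is witnessed by the uniform vector y_I = 2⁻ⁿ: its constraint for R follows
-- from p(z)² ≤ ½ ∑ₓ p(x)² for every p of degree at most t, z being the point violating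
-- g_R, and this holds as soon as the polynomials of degree at most t have dimension at most
-- 2ⁿ⁻¹, that is for 2t < n. For the upper bound, testing the constraint for each R on the
-- reproducing kernel of degree t centred at its violating point and summing over R makes
-- every y_I appear with the same factor, which is negative once fewer than 2ⁿ / 2n sets have
-- size above t; t = n − ⌊n^(1/3)⌋ is enough. Sums and products of reals are computed termwise
-- on Cauchy sequences, so all algebra takes place in ℚ.

module Submission where

open import Defs
open import Axiom.ExcludedMiddle using (ExcludedMiddle)
open import Data.Bool using (Bool; true; false; not; _xor_)
open import Data.Fin as Fin using (Fin)
open import Data.Fin.Subset using (Subset; inside; outside; ∁; ∣_∣; ⊥; _∈_; _∉_)
open import Data.Fin.Subset.Properties using (_∈?_; _⊆?_; x∈∁p⇒x∉p; ∣∁p∣≡n∸∣p∣; ∣p∣≤n; ∣⊥∣≡0)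
open import Data.Integer as ℤ using (+_)
open import Data.Nat as ℕ using (ℕ; zero; suc; z≤n; s≤s)
open import Data.Nat.Induction using (<-rec)
import Data.Nat.Properties as ℕ
import Data.Nat.Tactic.RingSolver as ℕSolver
open import Data.Product using (∃; ∃-syntax; _×_; _,_; proj₁; proj₂)
open import Data.Rational as ℚ using (ℚ; 0ℚ; 1ℚ; ½)
import Data.Rational.Properties as ℚ
open import Data.Rational.Solver using (module +-*-Solver)
open import Data.Sum using (_⊎_; inj₁; inj₂)
open import Data.Vec using ([]; _∷_; zipWith; here; there)
open import Function using (_∘_)
open import Level using (0ℓ)
open import Relation.Binary.PropositionalEquality
open import Relation.Nullary using (¬_; Dec; yes; no; does; contradiction)
open import Relation.Nullary.Decidable using (dec-true; dec-false)

-- Rational inequalities and the embedding of the naturals.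

≤-by-difference : ∀ {p q} d → 0ℚ ℚ.≤ d → p ℚ.+ d ≡ q → p ℚ.≤ q
≤-by-difference {p} d 0≤d refl = subst (ℚ._≤ p ℚ.+ d) (ℚ.+-identityʳ p) (ℚ.+-monoʳ-≤ p 0≤d)

0≤p*q : ∀ {p q} → 0ℚ ℚ.≤ p → 0ℚ ℚ.≤ q → 0ℚ ℚ.≤ p ℚ.* q
0≤p*q {p} {q} 0≤p 0≤q = subst (ℚ._≤ p ℚ.* q) (ℚ.*-zeroʳ p)
  (ℚ.*-monoˡ-≤-nonNeg p {{ℚ.nonNegative 0≤p}} 0≤q)

0≤p*p : ∀ p → 0ℚ ℚ.≤ p ℚ.* p
0≤p*p p = subst (0ℚ ℚ.≤_) (square p) (0≤p*q (ℚ.0≤∣p∣ p) (ℚ.0≤∣p∣ p))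
  where
  open +-*-Solver
  square : ∀ p → ℚ.∣ p ∣ ℚ.* ℚ.∣ p ∣ ≡ p ℚ.* p
  square p with ℚ.∣p∣≡p∨∣p∣≡-p p
  ... | inj₁ e = cong₂ ℚ._*_ e e
  ... | inj₂ e = trans (cong₂ ℚ._*_ e e) (solve 1 (λ p → :- p :* :- p := p :* p) refl p)

ι : ℕ → ℚ
ι n = (+ n) ℚ./ 1

ι-suc : ∀ n → ι (suc n) ≡ 1ℚ ℚ.+ ι n
ι-suc n = trans (suc-/ n 0) (ℚ.+-comm (ι n) 1ℚ)

ι-+ : ∀ m n → ι (m ℕ.+ n) ≡ ι m ℚ.+ ι n
ι-+ zero    n = sym (ℚ.+-identityˡ (ι n))
ι-+ (suc m) n = begin
  ι (suc (m ℕ.+ n))      ≡⟨ ι-suc (m ℕ.+ n) ⟩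
  1ℚ ℚ.+ ι (m ℕ.+ n)     ≡⟨ cong (1ℚ ℚ.+_) (ι-+ m n) ⟩
  1ℚ ℚ.+ (ι m ℚ.+ ι n)   ≡⟨ ℚ.+-assoc 1ℚ (ι m) (ι n) ⟨
  1ℚ ℚ.+ ι m ℚ.+ ι n     ≡⟨ cong (ℚ._+ ι n) (ι-suc m) ⟨
  ι (suc m) ℚ.+ ι n      ∎
  where open ≡-Reasoning

ι-* : ∀ m n → ι (m ℕ.* n) ≡ ι m ℚ.* ι n
ι-* zero    n = sym (ℚ.*-zeroˡ (ι n))
ι-* (suc m) n = begin
  ι (n ℕ.+ m ℕ.* n)              ≡⟨ ι-+ n (m ℕ.* n) ⟩
  ι n ℚ.+ ι (m ℕ.* n)            ≡⟨ cong₂ ℚ._+_ (sym (ℚ.*-identityˡ (ι n))) (ι-* m n) ⟩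
  1ℚ ℚ.* ι n ℚ.+ ι m ℚ.* ι n     ≡⟨ ℚ.*-distribʳ-+ (ι n) 1ℚ (ι m) ⟨
  (1ℚ ℚ.+ ι m) ℚ.* ι n           ≡⟨ cong (ℚ._* ι n) (ι-suc m) ⟨
  ι (suc m) ℚ.* ι n              ∎
  where open ≡-Reasoning

ι-mono-≤ : ∀ {m n} → m ℕ.≤ n → ι m ℚ.≤ ι n
ι-mono-≤ {m} {n} m≤n = /-mono m 0 n 0 (ℕ.*-monoˡ-≤ 1 m≤n)

0≤ι : ∀ n → 0ℚ ℚ.≤ ι n
0≤ι n = ι-mono-≤ (z≤n {n})

ι-mono-< : ∀ {m n} → m ℕ.< n → ι m ℚ.< ι n
ι-mono-< {m} {n} m<n = ℚ.<-≤-trans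
  (subst₂ ℚ._<_ (ℚ.+-identityˡ (ι m)) (sym (ι-suc m)) (ℚ.+-monoˡ-< (ι m) (ℚ.positive⁻¹ 1ℚ)))
  (ι-mono-≤ m<n)

2^ : ℕ → ℚ
2^ n = ι (2 ℕ.^ n)

2^-suc : ∀ n → 2^ (suc n) ≡ 2^ n ℚ.+ 2^ n
2^-suc n = trans (cong (λ m → ι (2 ℕ.^ n ℕ.+ m)) (ℕ.+-identityʳ (2 ℕ.^ n))) (ι-+ (2 ℕ.^ n) (2 ℕ.^ n))

-- Sums over all subsets of a finite set.

∑ : ∀ {n} → (Subset n → ℚ) → ℚ
∑ {zero}  f = f []
∑ {suc n} f = ∑ (f ∘ (outside ∷_)) ℚ.+ ∑ (f ∘ (inside ∷_))

∑-cong : ∀ {n} {f g : Subset n → ℚ} → (∀ X → f X ≡ g X) → ∑ f ≡ ∑ g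
∑-cong {zero}  h = h []
∑-cong {suc n} h = cong₂ ℚ._+_ (∑-cong (h ∘ (outside ∷_))) (∑-cong (h ∘ (inside ∷_)))

∑-mono : ∀ {n} {f g : Subset n → ℚ} → (∀ X → f X ℚ.≤ g X) → ∑ f ℚ.≤ ∑ g
∑-mono {zero}  h = h []
∑-mono {suc n} h = ℚ.+-mono-≤ (∑-mono (h ∘ (outside ∷_))) (∑-mono (h ∘ (inside ∷_)))

∑-zero : ∀ n → ∑ {n} (λ _ → 0ℚ) ≡ 0ℚ
∑-zero zero    = refl
∑-zero (suc n) = cong₂ ℚ._+_ (∑-zero n) (∑-zero n)

∑-one : ∀ n → ∑ {n} (λ _ → 1ℚ) ≡ 2^ n
∑-one zero    = refl
∑-one (suc n) = trans (cong₂ ℚ._+_ (∑-one n) (∑-one n)) (sym (2^-suc n))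

∑-+ : ∀ {n} (f g : Subset n → ℚ) → ∑ (λ X → f X ℚ.+ g X) ≡ ∑ f ℚ.+ ∑ g
∑-+ {zero}  f g = refl
∑-+ {suc n} f g = trans
  (cong₂ ℚ._+_ (∑-+ (f ∘ (outside ∷_)) (g ∘ (outside ∷_))) (∑-+ (f ∘ (inside ∷_)) (g ∘ (inside ∷_))))
  (solve 4 (λ a b c d → (a :+ b) :+ (c :+ d) := (a :+ c) :+ (b :+ d)) refl
    (∑ (f ∘ (outside ∷_))) (∑ (g ∘ (outside ∷_))) (∑ (f ∘ (inside ∷_))) (∑ (g ∘ (inside ∷_))))
  where open +-*-Solver

∑-*ˡ : ∀ {n} c (f : Subset n → ℚ) → ∑ (λ X → c ℚ.* f X) ≡ c ℚ.* ∑ f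
∑-*ˡ {zero}  c f = refl
∑-*ˡ {suc n} c f = trans
  (cong₂ ℚ._+_ (∑-*ˡ c (f ∘ (outside ∷_))) (∑-*ˡ c (f ∘ (inside ∷_))))
  (sym (ℚ.*-distribˡ-+ c _ _))

∑-*ʳ : ∀ {n} c (f : Subset n → ℚ) → ∑ (λ X → f X ℚ.* c) ≡ ∑ f ℚ.* c
∑-*ʳ c f = trans (∑-cong λ X → ℚ.*-comm (f X) c) (trans (∑-*ˡ c f) (ℚ.*-comm c (∑ f)))

∑-neg : ∀ {n} (f : Subset n → ℚ) → ∑ (λ X → ℚ.- f X) ≡ ℚ.- ∑ f
∑-neg {zero}  f = refl
∑-neg {suc n} f = trans
  (cong₂ ℚ._+_ (∑-neg (f ∘ (outside ∷_))) (∑-neg (f ∘ (inside ∷_))))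
  (sym (ℚ.neg-distrib-+ (∑ (f ∘ (outside ∷_))) (∑ (f ∘ (inside ∷_)))))

∑-*-neg : ∀ {n} (f g : Subset n → ℚ) → ∑ (λ X → f X ℚ.* ℚ.- g X) ≡ ℚ.- ∑ (λ X → f X ℚ.* g X)
∑-*-neg f g = trans (∑-cong λ X → sym (ℚ.neg-distribʳ-* (f X) (g X))) (∑-neg λ X → f X ℚ.* g X)

∑-swap : ∀ {m n} (f : Subset m → Subset n → ℚ) →
         ∑ (λ X → ∑ λ Y → f X Y) ≡ ∑ (λ Y → ∑ λ X → f X Y)
∑-swap {zero}  f = refl
∑-swap {suc m} f = trans
  (cong₂ ℚ._+_ (∑-swap (f ∘ (outside ∷_))) (∑-swap (f ∘ (inside ∷_))))
  (sym (∑-+ (λ Y → ∑ λ X → f (outside ∷ X) Y) (λ Y → ∑ λ X → f (inside ∷ X) Y)))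

∑-*-∑ : ∀ {m n} (f : Subset m → ℚ) (g : Subset n → ℚ) →
        ∑ f ℚ.* ∑ g ≡ ∑ (λ X → ∑ λ Y → f X ℚ.* g Y)
∑-*-∑ f g = trans (sym (∑-*ʳ (∑ g) f)) (∑-cong λ X → sym (∑-*ˡ (f X) g))

∑-∁ : ∀ {n} (f : Subset n → ℚ) → ∑ (f ∘ ∁) ≡ ∑ f
∑-∁ {zero}  f = refl
∑-∁ {suc n} f = trans
  (cong₂ ℚ._+_ (∑-∁ (f ∘ (inside ∷_))) (∑-∁ (f ∘ (outside ∷_))))
  (ℚ.+-comm (∑ (f ∘ (inside ∷_))) (∑ (f ∘ (outside ∷_))))

-- Agreement sets and zeta vectors.

-- X ⊕ R is the set of coordinates on which X and R agree; g_R (x_X) = ∣ X ⊕ R ∣ − ½.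
infixl 6 _⊕_
_⊕_ : ∀ {n} → Subset n → Subset n → Subset n
_⊕_ = zipWith λ x r → not (x xor r)

⊕-comm : ∀ {n} (X R : Subset n) → X ⊕ R ≡ R ⊕ X
⊕-comm []            []            = refl
⊕-comm (outside ∷ X) (outside ∷ R) = cong (inside ∷_) (⊕-comm X R)
⊕-comm (outside ∷ X) (inside ∷ R)  = cong (outside ∷_) (⊕-comm X R)
⊕-comm (inside ∷ X)  (outside ∷ R) = cong (outside ∷_) (⊕-comm X R)
⊕-comm (inside ∷ X)  (inside ∷ R)  = cong (inside ∷_) (⊕-comm X R)

∁R⊕R≡⊥ : ∀ {n} (R : Subset n) → ∁ R ⊕ R ≡ ⊥
∁R⊕R≡⊥ []            = refl
∁R⊕R≡⊥ (outside ∷ R) = cong (outside ∷_) (∁R⊕R≡⊥ R)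
∁R⊕R≡⊥ (inside ∷ R)  = cong (outside ∷_) (∁R⊕R≡⊥ R)

-- `X ↦ X ⊕ R` is an involution, so it only permutes the summands.
∑-⊕ : ∀ {n} (f : Subset n → ℚ) R → ∑ (λ X → f (X ⊕ R)) ≡ ∑ f
∑-⊕ f []            = refl
∑-⊕ f (outside ∷ R) = trans
  (cong₂ ℚ._+_ (∑-⊕ (f ∘ (inside ∷_)) R) (∑-⊕ (f ∘ (outside ∷_)) R))
  (ℚ.+-comm (∑ (f ∘ (inside ∷_))) (∑ (f ∘ (outside ∷_))))
∑-⊕ f (inside ∷ R)  = cong₂ ℚ._+_ (∑-⊕ (f ∘ (outside ∷_)) R) (∑-⊕ (f ∘ (inside ∷_)) R)

𝟙 : Bool → ℚ
𝟙 true  = 1ℚ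
𝟙 false = 0ℚ

-- The rational form of the zeta vectors. `ζ ⊥ Z` serves throughout as the indicator of `Z` being
-- empty.
ζ : ∀ {n} → Subset n → Subset n → ℚ
ζ X J = 𝟙 (does (J ⊆? X))

-- `X ⊕ R` is empty for `X = ∁ R` alone, so the weight is a point mass there.
∑-ζ⊥ : ∀ {n} (f : Subset n → ℚ) R → ∑ (λ X → ζ ⊥ (X ⊕ R) ℚ.* f X) ≡ f (∁ R)
∑-ζ⊥ f []            = ℚ.*-identityˡ (f [])
∑-ζ⊥ {suc n} f (outside ∷ R) = trans
  (cong₂ ℚ._+_
    (trans (∑-cong λ X → ℚ.*-zeroˡ (f (outside ∷ X))) (∑-zero n))
    (∑-ζ⊥ (f ∘ (inside ∷_)) R))
  (ℚ.+-identityˡ _)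
∑-ζ⊥ {suc n} f (inside ∷ R) = trans
  (cong₂ ℚ._+_
    (∑-ζ⊥ (f ∘ (outside ∷_)) R)
    (trans (∑-cong λ X → ℚ.*-zeroˡ (f (inside ∷ X))) (∑-zero n)))
  (ℚ.+-identityʳ _)

-- Characters of the cube.

-- χ S Z = (−1)^∣ S ∩ Z ∣.
χ : ∀ {n} → Subset n → Subset n → ℚ
χ []            []            = 1ℚ
χ (inside ∷ S)  (inside ∷ Z)  = ℚ.- χ S Z
χ (inside ∷ S)  (outside ∷ Z) = χ S Z
χ (outside ∷ S) (_ ∷ Z)       = χ S Z

χ-⊥ : ∀ {n} (S : Subset n) → χ S ⊥ ≡ 1ℚ
χ-⊥ []            = refl
χ-⊥ (inside ∷ S)  = χ-⊥ S
χ-⊥ (outside ∷ S) = χ-⊥ S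

-- An element of `Z` pairs the sets `S` with and without it, with opposite signs. If `Z` is empty,
-- every summand is 1.
∑-χ : ∀ {n} (Z : Subset n) → ∑ (λ S → χ S Z) ≡ 2^ n ℚ.* ζ ⊥ Z
∑-χ []                   = refl
∑-χ {suc n} (outside ∷ Z) = begin
  ∑ (λ S → χ S Z) ℚ.+ ∑ (λ S → χ S Z)        ≡⟨ cong₂ ℚ._+_ (∑-χ Z) (∑-χ Z) ⟩
  2^ n ℚ.* ζ ⊥ Z ℚ.+ 2^ n ℚ.* ζ ⊥ Z          ≡⟨ ℚ.*-distribʳ-+ (ζ ⊥ Z) (2^ n) (2^ n) ⟨
  (2^ n ℚ.+ 2^ n) ℚ.* ζ ⊥ Z                  ≡⟨ cong (ℚ._* ζ ⊥ Z) (2^-suc n) ⟨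
  2^ (suc n) ℚ.* ζ ⊥ Z                       ∎
  where open ≡-Reasoning
∑-χ {suc n} (inside ∷ Z) = begin
  ∑ (λ S → χ S Z) ℚ.+ ∑ (λ S → ℚ.- χ S Z)    ≡⟨ cong (∑ (λ S → χ S Z) ℚ.+_) (∑-neg (λ S → χ S Z)) ⟩
  ∑ (λ S → χ S Z) ℚ.- ∑ (λ S → χ S Z)        ≡⟨ ℚ.+-inverseʳ (∑ λ S → χ S Z) ⟩
  0ℚ                                         ≡⟨ ℚ.*-zeroʳ (2^ (suc n)) ⟨
  2^ (suc n) ℚ.* 0ℚ                          ∎
  where open ≡-Reasoning

∑-zero* : ∀ {n} (f : Subset n → ℚ) → ∑ (λ X → 0ℚ ℚ.* f X) ≡ 0ℚ
∑-zero* f = trans (∑-*ˡ 0ℚ f) (ℚ.*-zeroˡ (∑ f))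

-- Some coordinate lies in `S` but not in `J`. Flipping it in `X` keeps the monomial and negates the
-- character, so the two halves of the sum cancel.
∑-ζχ≡0 : ∀ {n} (J S R : Subset n) → ∣ J ∣ ℕ.< ∣ S ∣ →
         ∑ (λ X → ζ X J ℚ.* χ S (X ⊕ R)) ≡ 0ℚ
∑-ζχ≡0 (outside ∷ J) (outside ∷ S) (_ ∷ R) lt = cong₂ ℚ._+_ (∑-ζχ≡0 J S R lt) (∑-ζχ≡0 J S R lt)
∑-ζχ≡0 (inside ∷ J)  (outside ∷ S) (_ ∷ R) lt =
  cong₂ ℚ._+_ (∑-zero* λ X → χ S (X ⊕ R)) (∑-ζχ≡0 J S R (ℕ.<-trans (ℕ.n<1+n ∣ J ∣) lt))
∑-ζχ≡0 (inside ∷ J)  (inside ∷ S) (outside ∷ R) (s≤s lt) =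
  cong₂ ℚ._+_ (∑-zero* λ X → ℚ.- χ S (X ⊕ R)) (∑-ζχ≡0 J S R lt)
∑-ζχ≡0 (inside ∷ J)  (inside ∷ S) (inside ∷ R) (s≤s lt) =
  cong₂ ℚ._+_ (∑-zero* λ X → χ S (X ⊕ R))
    (trans (∑-*-neg (λ X → ζ X J) (λ X → χ S (X ⊕ R))) (cong ℚ.-_ (∑-ζχ≡0 J S R lt)))
∑-ζχ≡0 (outside ∷ J) (inside ∷ S) (outside ∷ R) lt =
  trans (cong (ℚ._+ c) (∑-*-neg (λ X → ζ X J) (λ X → χ S (X ⊕ R)))) (ℚ.+-inverseˡ c)
  where c = ∑ λ X → ζ X J ℚ.* χ S (X ⊕ R)
∑-ζχ≡0 (outside ∷ J) (inside ∷ S) (inside ∷ R) lt =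
  trans (cong (c ℚ.+_) (∑-*-neg (λ X → ζ X J) (λ X → χ S (X ⊕ R)))) (ℚ.+-inverseʳ c)
  where c = ∑ λ X → ζ X J ℚ.* χ S (X ⊕ R)

-- Polynomials given by monomial coefficients.

-- X ↦ ∑ J v_J ζ_X(J) is the polynomial with monomial coefficients v at the point x_X.
eval : ∀ {n} → (Subset n → ℚ) → Subset n → ℚ
eval v X = ∑ λ J → v J ℚ.* ζ X J

-- The monomial coefficients of X ↦ χ S (X ⊕ R).
coeffχ : ∀ {n} → Subset n → Subset n → Subset n → ℚ
coeffχ []            []            []            = 1ℚ
coeffχ (outside ∷ S) (_ ∷ R)       (outside ∷ J) = coeffχ S R J
coeffχ (outside ∷ S) (_ ∷ R)       (inside ∷ J)  = 0ℚ
coeffχ (inside ∷ S)  (outside ∷ R) (outside ∷ J) = ℚ.- coeffχ S R J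
coeffχ (inside ∷ S)  (outside ∷ R) (inside ∷ J)  = coeffχ S R J ℚ.+ coeffχ S R J
coeffχ (inside ∷ S)  (inside ∷ R)  (outside ∷ J) = coeffχ S R J
coeffχ (inside ∷ S)  (inside ∷ R)  (inside ∷ J)  = ℚ.- (coeffχ S R J ℚ.+ coeffχ S R J)

-- The character is a product over `S` of the factors 2x - 1 (outside `R`) and 1 - 2x (inside `R`),
-- so only monomials `J` contained in `S` occur.
coeffχ-degree : ∀ {n} (S R J : Subset n) → ∣ S ∣ ℕ.< ∣ J ∣ → coeffχ S R J ≡ 0ℚ
coeffχ-degree (outside ∷ S) (_ ∷ R)       (outside ∷ J) lt = coeffχ-degree S R J lt
coeffχ-degree (outside ∷ S) (_ ∷ R)       (inside ∷ J)  lt = refl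
coeffχ-degree (inside ∷ S)  (outside ∷ R) (outside ∷ J) lt =
  cong ℚ.-_ (coeffχ-degree S R J (ℕ.<-trans (ℕ.n<1+n ∣ S ∣) lt))
coeffχ-degree (inside ∷ S)  (outside ∷ R) (inside ∷ J)  (s≤s lt) =
  cong (λ c → c ℚ.+ c) (coeffχ-degree S R J lt)
coeffχ-degree (inside ∷ S)  (inside ∷ R)  (outside ∷ J) lt =
  coeffχ-degree S R J (ℕ.<-trans (ℕ.n<1+n ∣ S ∣) lt)
coeffχ-degree (inside ∷ S)  (inside ∷ R)  (inside ∷ J)  (s≤s lt) =
  cong (λ c → ℚ.- (c ℚ.+ c)) (coeffχ-degree S R J lt)

eval-coeffχ : ∀ {n} (S R X : Subset n) → eval (coeffχ S R) X ≡ χ S (X ⊕ R)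
eval-coeffχ []            []      []            = refl
eval-coeffχ {suc n} (outside ∷ S) (r ∷ R) (x ∷ X) = trans
  (cong₂ ℚ._+_ (eval-coeffχ S R X) (∑-zero* λ J → ζ (x ∷ X) (inside ∷ J)))
  (ℚ.+-identityʳ _)
eval-coeffχ {suc n} (inside ∷ S) (outside ∷ R) (outside ∷ X) = trans
  (cong₂ ℚ._+_
    (trans (∑-cong λ J → sym (ℚ.neg-distribˡ-* (coeffχ S R J) (ζ X J)))
      (trans (∑-neg λ J → coeffχ S R J ℚ.* ζ X J) (cong ℚ.-_ (eval-coeffχ S R X))))
    (trans (∑-cong λ J → ℚ.*-zeroʳ (coeffχ S R J ℚ.+ coeffχ S R J)) (∑-zero n)))
  (ℚ.+-identityʳ _)
eval-coeffχ {suc n} (inside ∷ S) (inside ∷ R) (outside ∷ X) = trans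
  (cong₂ ℚ._+_ (eval-coeffχ S R X)
    (trans (∑-cong λ J → ℚ.*-zeroʳ (ℚ.- (coeffχ S R J ℚ.+ coeffχ S R J))) (∑-zero n)))
  (ℚ.+-identityʳ _)
eval-coeffχ {suc n} (inside ∷ S) (outside ∷ R) (inside ∷ X) = trans
  (sym (∑-+ (λ J → ℚ.- coeffχ S R J ℚ.* ζ X J) _))
  (trans (∑-cong λ J → solve 2 (λ c z → :- c :* z :+ (c :+ c) :* z := c :* z) refl
           (coeffχ S R J) (ζ X J))
    (eval-coeffχ S R X))
  where open +-*-Solver
eval-coeffχ {suc n} (inside ∷ S) (inside ∷ R) (inside ∷ X) = trans
  (sym (∑-+ (λ J → coeffχ S R J ℚ.* ζ X J) _))
  (trans (∑-cong λ J → solve 2 (λ c z → c :* z :+ :- (c :+ c) :* z := :- (c :* z)) refl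
           (coeffχ S R J) (ζ X J))
    (trans (∑-neg λ J → coeffχ S R J ℚ.* ζ X J) (cong ℚ.-_ (eval-coeffχ S R X))))
  where open +-*-Solver

p≤q⇒0≤q-p : ∀ {p q} → p ℚ.≤ q → 0ℚ ℚ.≤ q ℚ.- p
p≤q⇒0≤q-p {p} {q} p≤q = subst (ℚ._≤ q ℚ.- p) (ℚ.+-inverseʳ p) (ℚ.+-monoˡ-≤ (ℚ.- p) p≤q)

0≤𝟙 : ∀ b → 0ℚ ℚ.≤ 𝟙 b
0≤𝟙 true  = ℚ.nonNegative⁻¹ 1ℚ
0≤𝟙 false = ℚ.≤-refl

𝟙≤1 : ∀ b → 𝟙 b ℚ.≤ 1ℚ
𝟙≤1 true  = ℚ.≤-refl
𝟙≤1 false = ℚ.nonNegative⁻¹ 1ℚ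

-- Truncation by degree and the reproducing kernel.

deg≤ : ∀ {n} → ℕ → Subset n → ℚ
deg≤ t S = 𝟙 (does (∣ S ∣ ℕ.≤? t))

deg≤-yes : ∀ {n t} {S : Subset n} → ∣ S ∣ ℕ.≤ t → deg≤ t S ≡ 1ℚ
deg≤-yes {t = t} {S} p = cong 𝟙 (dec-true (∣ S ∣ ℕ.≤? t) p)

deg≤-no : ∀ {n t} {S : Subset n} → t ℕ.< ∣ S ∣ → deg≤ t S ≡ 0ℚ
deg≤-no {t = t} {S} p = cong 𝟙 (dec-false (∣ S ∣ ℕ.≤? t) (ℕ.<⇒≱ p))

-- Also the dimension of the space of polynomials of degree at most `t` on the cube.
ball : ℕ → ℕ → ℚ
ball n t = ∑ {n} (deg≤ t)

-- X ↦ 2⁻ⁿ kernel t (X ⊕ R) is the reproducing kernel at x_{∁ R} of the polynomials of degree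
-- at most t, for the inner product ∑ₓ p(x) q(x).
kernel : ∀ {n} → ℕ → Subset n → ℚ
kernel t Z = ∑ λ S → deg≤ t S ℚ.* χ S Z

-- The monomial coefficients of `X ↦ kernel t (X ⊕ R)`, the form in which the kernel can be used as
-- a test vector.
coeff : ∀ {n} → ℕ → Subset n → Subset n → ℚ
coeff t R J = ∑ λ S → deg≤ t S ℚ.* coeffχ S R J

HasDegree≤ : ∀ {n} → ℕ → (Subset n → ℚ) → Set
HasDegree≤ t v = ∀ J → t ℕ.< ∣ J ∣ → v J ≡ 0ℚ

coeff-degree : ∀ {n} t (R : Subset n) → HasDegree≤ t (coeff t R)
coeff-degree {n} t R J t<∣J∣ = trans (∑-cong term) (∑-zero n)
  where
  term : ∀ S → deg≤ t S ℚ.* coeffχ S R J ≡ 0ℚ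
  term S with ℕ.≤-<-connex ∣ S ∣ t
  ... | inj₁ ∣S∣≤t = trans (cong (deg≤ t S ℚ.*_) (coeffχ-degree S R J (ℕ.≤-<-trans ∣S∣≤t t<∣J∣)))
                           (ℚ.*-zeroʳ (deg≤ t S))
  ... | inj₂ t<∣S∣ = trans (cong (ℚ._* coeffχ S R J) (deg≤-no {S = S} t<∣S∣)) (ℚ.*-zeroˡ (coeffχ S R J))

eval-coeff : ∀ {n} t (R X : Subset n) → eval (coeff t R) X ≡ kernel t (X ⊕ R)
eval-coeff t R X = begin
  ∑ (λ J → ∑ (λ S → deg≤ t S ℚ.* coeffχ S R J) ℚ.* ζ X J)
    ≡⟨ ∑-cong (λ J → ∑-*ʳ (ζ X J) (λ S → deg≤ t S ℚ.* coeffχ S R J)) ⟨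
  ∑ (λ J → ∑ λ S → deg≤ t S ℚ.* coeffχ S R J ℚ.* ζ X J)
    ≡⟨ ∑-swap (λ J S → deg≤ t S ℚ.* coeffχ S R J ℚ.* ζ X J) ⟩
  ∑ (λ S → ∑ λ J → deg≤ t S ℚ.* coeffχ S R J ℚ.* ζ X J)
    ≡⟨ ∑-cong (λ S → trans
         (∑-cong λ J → ℚ.*-assoc (deg≤ t S) (coeffχ S R J) (ζ X J))
         (trans (∑-*ˡ (deg≤ t S) λ J → coeffχ S R J ℚ.* ζ X J)
           (cong (deg≤ t S ℚ.*_) (eval-coeffχ S R X)))) ⟩
  kernel t (X ⊕ R) ∎
  where open ≡-Reasoning

-- Characters of degree above `t` are orthogonal to the monomial, so the truncation can be lifted.
-- The full sum of characters is 2ⁿ times the point mass at `∁ R`.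
∑-ζ-kernel : ∀ {n} t (J R : Subset n) → ∣ J ∣ ℕ.≤ t →
             ∑ (λ X → ζ X J ℚ.* kernel t (X ⊕ R)) ≡ 2^ n ℚ.* ζ (∁ R) J
∑-ζ-kernel {n} t J R ∣J∣≤t = begin
  ∑ (λ X → ζ X J ℚ.* ∑ λ S → deg≤ t S ℚ.* χ S (X ⊕ R))
    ≡⟨ ∑-cong (λ X → ∑-*ˡ (ζ X J) (λ S → deg≤ t S ℚ.* χ S (X ⊕ R))) ⟨
  ∑ (λ X → ∑ λ S → ζ X J ℚ.* (deg≤ t S ℚ.* χ S (X ⊕ R)))
    ≡⟨ ∑-swap (λ X S → ζ X J ℚ.* (deg≤ t S ℚ.* χ S (X ⊕ R))) ⟩
  ∑ (λ S → ∑ λ X → ζ X J ℚ.* (deg≤ t S ℚ.* χ S (X ⊕ R)))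
    ≡⟨ ∑-cong untruncate ⟩
  ∑ (λ S → ∑ λ X → ζ X J ℚ.* χ S (X ⊕ R))
    ≡⟨ ∑-swap (λ X S → ζ X J ℚ.* χ S (X ⊕ R)) ⟨
  ∑ (λ X → ∑ λ S → ζ X J ℚ.* χ S (X ⊕ R))
    ≡⟨ ∑-cong (λ X → trans (∑-*ˡ (ζ X J) λ S → χ S (X ⊕ R)) (cong (ζ X J ℚ.*_) (∑-χ (X ⊕ R)))) ⟩
  ∑ (λ X → ζ X J ℚ.* (2^ n ℚ.* ζ ⊥ (X ⊕ R)))
    ≡⟨ ∑-cong (λ X → solve 3 (λ a b c → a :* (b :* c) := b :* (c :* a)) refl
                       (ζ X J) (2^ n) (ζ ⊥ (X ⊕ R))) ⟩
  ∑ (λ X → 2^ n ℚ.* (ζ ⊥ (X ⊕ R) ℚ.* ζ X J))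
    ≡⟨ ∑-*ˡ (2^ n) (λ X → ζ ⊥ (X ⊕ R) ℚ.* ζ X J) ⟩
  2^ n ℚ.* ∑ (λ X → ζ ⊥ (X ⊕ R) ℚ.* ζ X J)
    ≡⟨ cong (2^ n ℚ.*_) (∑-ζ⊥ (λ X → ζ X J) R) ⟩
  2^ n ℚ.* ζ (∁ R) J ∎
  where
  open ≡-Reasoning
  open +-*-Solver
  untruncate : ∀ S → ∑ (λ X → ζ X J ℚ.* (deg≤ t S ℚ.* χ S (X ⊕ R))) ≡
                     ∑ (λ X → ζ X J ℚ.* χ S (X ⊕ R))
  untruncate S with ℕ.≤-<-connex ∣ S ∣ t
  ... | inj₁ ∣S∣≤t = ∑-cong λ X → cong (ζ X J ℚ.*_)
    (trans (cong (ℚ._* χ S (X ⊕ R)) (deg≤-yes {S = S} ∣S∣≤t)) (ℚ.*-identityˡ (χ S (X ⊕ R))))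
  ... | inj₂ t<∣S∣ = trans
    (∑-cong λ X → trans
      (cong (ζ X J ℚ.*_) (trans (cong (ℚ._* χ S (X ⊕ R)) (deg≤-no {S = S} t<∣S∣)) (ℚ.*-zeroˡ (χ S (X ⊕ R)))))
      (ℚ.*-zeroʳ (ζ X J)))
    (trans (∑-zero n) (sym (∑-ζχ≡0 J S R (ℕ.≤-<-trans ∣J∣≤t t<∣S∣))))

-- By linearity this reduces to single monomials: those of size at most `t` are covered by
-- `∑-ζ-kernel`, the others have coefficient zero.
reproducing : ∀ {n} t (v : Subset n → ℚ) → HasDegree≤ t v → ∀ R →
              ∑ (λ X → eval v X ℚ.* kernel t (X ⊕ R)) ≡ 2^ n ℚ.* eval v (∁ R)
reproducing {n} t v degv R = begin
  ∑ (λ X → eval v X ℚ.* kernel t (X ⊕ R))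
    ≡⟨ ∑-cong (λ X → ∑-*ʳ (kernel t (X ⊕ R)) (λ J → v J ℚ.* ζ X J)) ⟨
  ∑ (λ X → ∑ λ J → v J ℚ.* ζ X J ℚ.* kernel t (X ⊕ R))
    ≡⟨ ∑-swap (λ X J → v J ℚ.* ζ X J ℚ.* kernel t (X ⊕ R)) ⟩
  ∑ (λ J → ∑ λ X → v J ℚ.* ζ X J ℚ.* kernel t (X ⊕ R))
    ≡⟨ ∑-cong (λ J → trans
         (∑-cong λ X → ℚ.*-assoc (v J) (ζ X J) (kernel t (X ⊕ R)))
         (∑-*ˡ (v J) λ X → ζ X J ℚ.* kernel t (X ⊕ R))) ⟩
  ∑ (λ J → v J ℚ.* ∑ λ X → ζ X J ℚ.* kernel t (X ⊕ R))
    ≡⟨ ∑-cong monomial ⟩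
  ∑ (λ J → 2^ n ℚ.* (v J ℚ.* ζ (∁ R) J))
    ≡⟨ ∑-*ˡ (2^ n) (λ J → v J ℚ.* ζ (∁ R) J) ⟩
  2^ n ℚ.* eval v (∁ R) ∎
  where
  open ≡-Reasoning
  open +-*-Solver
  monomial : ∀ J → v J ℚ.* ∑ (λ X → ζ X J ℚ.* kernel t (X ⊕ R)) ≡ 2^ n ℚ.* (v J ℚ.* ζ (∁ R) J)
  monomial J with ℕ.≤-<-connex ∣ J ∣ t
  ... | inj₁ ∣J∣≤t = trans (cong (v J ℚ.*_) (∑-ζ-kernel t J R ∣J∣≤t))
    (solve 3 (λ a b c → a :* (b :* c) := b :* (a :* c)) refl (v J) (2^ n) (ζ (∁ R) J))
  ... | inj₂ t<∣J∣ rewrite degv J t<∣J∣ =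
    solve 3 (λ a b c → con 0ℚ :* a := b :* (con 0ℚ :* c)) refl
      (∑ λ X → ζ X J ℚ.* kernel t (X ⊕ R)) (2^ n) (ζ (∁ R) J)

kernel-⊥ : ∀ n t → kernel {n} t ⊥ ≡ ball n t
kernel-⊥ n t = ∑-cong {n} λ S → trans (cong (deg≤ t S ℚ.*_) (χ-⊥ S)) (ℚ.*-identityʳ (deg≤ t S))

-- The kernel reproduces itself, and at its own centre every character is 1, which leaves the number
-- of characters in the truncation.
∑-kernel² : ∀ {n} t (R : Subset n) →
            ∑ (λ X → kernel t (X ⊕ R) ℚ.* kernel t (X ⊕ R)) ≡ 2^ n ℚ.* ball n t
∑-kernel² {n} t R = begin
  ∑ (λ X → kernel t (X ⊕ R) ℚ.* kernel t (X ⊕ R))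
    ≡⟨ ∑-cong (λ X → cong (ℚ._* kernel t (X ⊕ R)) (eval-coeff t R X)) ⟨
  ∑ (λ X → eval (coeff t R) X ℚ.* kernel t (X ⊕ R))
    ≡⟨ reproducing t (coeff t R) (coeff-degree t R) R ⟩
  2^ n ℚ.* eval (coeff t R) (∁ R)
    ≡⟨ cong (2^ n ℚ.*_) (trans (eval-coeff t R (∁ R)) (cong (kernel t) (∁R⊕R≡⊥ R))) ⟩
  2^ n ℚ.* kernel t (⊥ {n})
    ≡⟨ cong (2^ n ℚ.*_) (kernel-⊥ n t) ⟩
  2^ n ℚ.* ball n t ∎
  where open ≡-Reasoning

-- Weighted sums of squares of polynomials of low degree.

-- With `Z = X ⊕ R` this bounds the constraint value `∣Z∣ − ½` below by ½ minus the indicator of the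
-- violating point.
1≤∣Z∣+ζ⊥ : ∀ {n} (Z : Subset n) → 1ℚ ℚ.≤ ι ∣ Z ∣ ℚ.+ ζ ⊥ Z
1≤∣Z∣+ζ⊥ []            = ℚ.≤-refl
1≤∣Z∣+ζ⊥ (outside ∷ Z) = 1≤∣Z∣+ζ⊥ Z
1≤∣Z∣+ζ⊥ (inside ∷ Z)  = subst (1ℚ ℚ.≤_) (sym (ℚ.+-identityʳ (ι (suc ∣ Z ∣)))) (ι-mono-≤ {1} {suc ∣ Z ∣} (s≤s z≤n))

-- The matching upper bound: the size is at most `n`, and 0 at the empty set. It drives
-- `kernelEnergy≤`.
∣Z∣+nζ⊥≤n : ∀ {n} (Z : Subset n) → ι ∣ Z ∣ ℚ.+ ι n ℚ.* ζ ⊥ Z ℚ.≤ ι n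
∣Z∣+nζ⊥≤n []                    = ℚ.≤-refl
∣Z∣+nζ⊥≤n {suc n} (outside ∷ Z) = begin
  ι ∣ Z ∣ ℚ.+ ι (suc n) ℚ.* ζ ⊥ Z
    ≡⟨ cong (λ q → ι ∣ Z ∣ ℚ.+ q ℚ.* ζ ⊥ Z) (ι-suc n) ⟩
  ι ∣ Z ∣ ℚ.+ (1ℚ ℚ.+ ι n) ℚ.* ζ ⊥ Z
    ≡⟨ solve 3 (λ a b c → a :+ (con 1ℚ :+ b) :* c := c :+ (a :+ b :* c)) refl (ι ∣ Z ∣) (ι n) (ζ ⊥ Z) ⟩
  ζ ⊥ Z ℚ.+ (ι ∣ Z ∣ ℚ.+ ι n ℚ.* ζ ⊥ Z)
    ≤⟨ ℚ.+-mono-≤ (𝟙≤1 (does (Z ⊆? ⊥))) (∣Z∣+nζ⊥≤n Z) ⟩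
  1ℚ ℚ.+ ι n
    ≡⟨ ι-suc n ⟨
  ι (suc n) ∎
  where
  open ℚ.≤-Reasoning
  open +-*-Solver
∣Z∣+nζ⊥≤n {suc n} (inside ∷ Z) = subst (ℚ._≤ ι (suc n))
  (sym (trans (cong (ι (suc ∣ Z ∣) ℚ.+_) (ℚ.*-zeroʳ (ι (suc n)))) (ℚ.+-identityʳ _)))
  (ι-mono-≤ (s≤s (∣p∣≤n Z)))

0<2^ : ∀ n → 0ℚ ℚ.< 2^ n
0<2^ n = ι-mono-< (ℕ.m^n>0 2 n)

-- The bound comes from ∑ X (2ⁿ p(X) − 2 p(x_{∁ R}) kernel(X ⊕ R))² ≥ 0.
peak-bound : ∀ {n} t (v : Subset n → ℚ) → HasDegree≤ t v → ball n t ℚ.+ ball n t ℚ.≤ 2^ n → ∀ R →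
             eval v (∁ R) ℚ.* eval v (∁ R) ℚ.≤ ½ ℚ.* ∑ (λ X → eval v X ℚ.* eval v X)
peak-bound {n} t v degv 2B≤N R =
  ℚ.*-cancelˡ-≤-pos (N ℚ.* N) {{ℚ.pos*pos⇒pos N {{N>0}} N {{N>0}}}}
    -- The slack is half the sum of squares plus p₀² N (N - 2B). The second term absorbs the gap
    -- between the kernel's norm N B and N²/2; the bound on the dimension makes it nonnegative.
    (≤-by-difference (½ ℚ.* D ℚ.+ p₀ ℚ.* p₀ ℚ.* N ℚ.* (N ℚ.- (B ℚ.+ B)))
      (ℚ.+-mono-≤ (0≤p*q (ℚ.nonNegative⁻¹ ½) 0≤D)
        (0≤p*q (0≤p*q (0≤p*p p₀) (0≤ι (2 ℕ.^ n))) (p≤q⇒0≤q-p 2B≤N)))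
      (trans (cong (λ d → N ℚ.* N ℚ.* (p₀ ℚ.* p₀) ℚ.+ (½ ℚ.* d ℚ.+ p₀ ℚ.* p₀ ℚ.* N ℚ.* (N ℚ.- (B ℚ.+ B)))) D≡)
        (solve 4 (λ N p₀ A B →
           N :* N :* (p₀ :* p₀) :+ (con ½ :* (N :* N :* A :- (con 1ℚ :+ con 1ℚ) :* N :* (p₀ :+ p₀) :* (N :* p₀)
             :+ (p₀ :+ p₀) :* (p₀ :+ p₀) :* (N :* B)) :+ p₀ :* p₀ :* N :* (N :- (B :+ B)))
           := N :* N :* (con ½ :* A)) refl N p₀ A B)))
  where
  open +-*-Solver
  N B p₀ A D : ℚ
  N = 2^ n
  B = ball n t
  p₀ = eval v (∁ R)
  A = ∑ λ X → eval v X ℚ.* eval v X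
  d : Subset n → ℚ
  d X = N ℚ.* eval v X ℚ.- (p₀ ℚ.+ p₀) ℚ.* kernel t (X ⊕ R)
  D = ∑ λ X → d X ℚ.* d X
  N>0 : ℚ.Positive N
  N>0 = ℚ.positive (0<2^ n)
  0≤D : 0ℚ ℚ.≤ D
  0≤D = subst (ℚ._≤ D) (∑-zero n) (∑-mono λ X → 0≤p*p (d X))
  pk kk : Subset n → ℚ
  pk X = eval v X ℚ.* kernel t (X ⊕ R)
  kk X = kernel t (X ⊕ R) ℚ.* kernel t (X ⊕ R)
  b c : ℚ
  b = ℚ.- ((1ℚ ℚ.+ 1ℚ) ℚ.* N ℚ.* (p₀ ℚ.+ p₀))
  c = (p₀ ℚ.+ p₀) ℚ.* (p₀ ℚ.+ p₀)
  D≡ : D ≡ N ℚ.* N ℚ.* A ℚ.- (1ℚ ℚ.+ 1ℚ) ℚ.* N ℚ.* (p₀ ℚ.+ p₀) ℚ.* (N ℚ.* p₀) ℚ.+ c ℚ.* (N ℚ.* B)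
  D≡ = begin
    D
      ≡⟨ ∑-cong (λ X → solve 4 (λ N p q k → (N :* p :- q :* k) :* (N :* p :- q :* k)
           := N :* N :* (p :* p) :+ (:- ((con 1ℚ :+ con 1ℚ) :* N :* q)) :* (p :* k) :+ q :* q :* (k :* k))
           refl N (eval v X) (p₀ ℚ.+ p₀) (kernel t (X ⊕ R))) ⟩
    ∑ (λ X → N ℚ.* N ℚ.* (eval v X ℚ.* eval v X) ℚ.+ b ℚ.* pk X ℚ.+ c ℚ.* kk X)
      ≡⟨ ∑-+ (λ X → N ℚ.* N ℚ.* (eval v X ℚ.* eval v X) ℚ.+ b ℚ.* pk X) (λ X → c ℚ.* kk X) ⟩
    ∑ (λ X → N ℚ.* N ℚ.* (eval v X ℚ.* eval v X) ℚ.+ b ℚ.* pk X) ℚ.+ ∑ (λ X → c ℚ.* kk X)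
      ≡⟨ cong₂ ℚ._+_
           (trans (∑-+ (λ X → N ℚ.* N ℚ.* (eval v X ℚ.* eval v X)) (λ X → b ℚ.* pk X))
             (cong₂ ℚ._+_ (∑-*ˡ (N ℚ.* N) λ X → eval v X ℚ.* eval v X)
               (trans (∑-*ˡ b pk) (cong (b ℚ.*_) (reproducing t v degv R)))))
           (trans (∑-*ˡ c kk) (cong (c ℚ.*_) (∑-kernel² t R))) ⟩
    N ℚ.* N ℚ.* A ℚ.+ b ℚ.* (N ℚ.* p₀) ℚ.+ c ℚ.* (N ℚ.* B)
      ≡⟨ cong (λ q → N ℚ.* N ℚ.* A ℚ.+ q ℚ.+ c ℚ.* (N ℚ.* B))
           (ℚ.neg-distribˡ-* ((1ℚ ℚ.+ 1ℚ) ℚ.* N ℚ.* (p₀ ℚ.+ p₀)) (N ℚ.* p₀)) ⟨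
    N ℚ.* N ℚ.* A ℚ.- (1ℚ ℚ.+ 1ℚ) ℚ.* N ℚ.* (p₀ ℚ.+ p₀) ℚ.* (N ℚ.* p₀) ℚ.+ c ℚ.* (N ℚ.* B) ∎
    where open ≡-Reasoning

-- The weight is -½ at `∁ R` and at least ½ elsewhere. Hence the sum is at least half of ∑ p² minus
-- p(`∁ R`)², which `peak-bound` makes nonnegative.
weighted-square-nonneg : ∀ {n} t (v : Subset n → ℚ) → HasDegree≤ t v → ball n t ℚ.+ ball n t ℚ.≤ 2^ n →
  ∀ R → 0ℚ ℚ.≤ ∑ (λ X → (ι ∣ X ⊕ R ∣ ℚ.- ½) ℚ.* (eval v X ℚ.* eval v X))
weighted-square-nonneg {n} t v degv 2B≤N R = begin
  0ℚ
    ≤⟨ p≤q⇒0≤q-p (peak-bound t v degv 2B≤N R) ⟩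
  ½ ℚ.* ∑ (λ X → p X ℚ.* p X) ℚ.- p (∁ R) ℚ.* p (∁ R)
    ≡⟨ cong₂ ℚ._-_ (sym (∑-*ˡ ½ λ X → p X ℚ.* p X)) (sym (∑-ζ⊥ (λ X → p X ℚ.* p X) R)) ⟩
  ∑ (λ X → ½ ℚ.* (p X ℚ.* p X)) ℚ.- ∑ (λ X → ζ ⊥ (X ⊕ R) ℚ.* (p X ℚ.* p X))
    ≡⟨ cong (∑ (λ X → ½ ℚ.* (p X ℚ.* p X)) ℚ.+_) (∑-neg λ X → ζ ⊥ (X ⊕ R) ℚ.* (p X ℚ.* p X)) ⟨
  ∑ (λ X → ½ ℚ.* (p X ℚ.* p X)) ℚ.+ ∑ (λ X → ℚ.- (ζ ⊥ (X ⊕ R) ℚ.* (p X ℚ.* p X)))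
    ≡⟨ ∑-+ (λ X → ½ ℚ.* (p X ℚ.* p X)) (λ X → ℚ.- (ζ ⊥ (X ⊕ R) ℚ.* (p X ℚ.* p X))) ⟨
  ∑ (λ X → ½ ℚ.* (p X ℚ.* p X) ℚ.- ζ ⊥ (X ⊕ R) ℚ.* (p X ℚ.* p X))
    ≤⟨ ∑-mono (λ X → ≤-by-difference
         ((ι ∣ X ⊕ R ∣ ℚ.+ ζ ⊥ (X ⊕ R) ℚ.- 1ℚ) ℚ.* (p X ℚ.* p X))
         (0≤p*q (p≤q⇒0≤q-p (1≤∣Z∣+ζ⊥ (X ⊕ R))) (0≤p*p (p X)))
         (solve 3 (λ i z s → (con ½ :* s :- z :* s) :+ (i :+ z :- con 1ℚ) :* s := (i :- con ½) :* s)
           refl (ι ∣ X ⊕ R ∣) (ζ ⊥ (X ⊕ R)) (p X ℚ.* p X))) ⟩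
  ∑ (λ X → (ι ∣ X ⊕ R ∣ ℚ.- ½) ℚ.* (p X ℚ.* p X)) ∎
  where
  open ℚ.≤-Reasoning
  open +-*-Solver
  p = eval v

-- The energy of the kernel.

-- The sum over the whole cube of g_R times the squared kernel centred at `∁ R`. By `∑-⊕` it is the
-- same for every `R`.
kernelEnergy : ℕ → ℕ → ℚ
kernelEnergy n t = ∑ {n} λ Z → (ι ∣ Z ∣ ℚ.- ½) ℚ.* (kernel t Z ℚ.* kernel t Z)

kernelEnergy≤ : ∀ n t → kernelEnergy n t ℚ.≤
                (ι n ℚ.- ½) ℚ.* (2^ n ℚ.* ball n t) ℚ.- ι n ℚ.* (ball n t ℚ.* ball n t)
kernelEnergy≤ n t = begin
  kernelEnergy n t
    -- The shift by a fixed `R` brings the sum into the form in which `∑-kernel²` and `∑-ζ⊥` apply.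
    ≡⟨ ∑-⊕ (λ Z → (ι ∣ Z ∣ ℚ.- ½) ℚ.* (kernel t Z ℚ.* kernel t Z)) R ⟨
  ∑ (λ X → (ι ∣ X ⊕ R ∣ ℚ.- ½) ℚ.* k² X)
    ≤⟨ ∑-mono (λ X → ≤-by-difference
         ((ι n ℚ.- (ι ∣ X ⊕ R ∣ ℚ.+ ι n ℚ.* ζ ⊥ (X ⊕ R))) ℚ.* k² X)
         (0≤p*q (p≤q⇒0≤q-p (∣Z∣+nζ⊥≤n (X ⊕ R))) (0≤p*p (kernel t (X ⊕ R))))
         (solve 4 (λ n i z s → (i :- con ½) :* s :+ (n :- (i :+ n :* z)) :* s
                     := (n :- con ½) :* s :+ (:- n) :* (z :* s))
           refl (ι n) (ι ∣ X ⊕ R ∣) (ζ ⊥ (X ⊕ R)) (k² X))) ⟩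
  ∑ (λ X → (ι n ℚ.- ½) ℚ.* k² X ℚ.+ (ℚ.- ι n) ℚ.* (ζ ⊥ (X ⊕ R) ℚ.* k² X))
    ≡⟨ ∑-+ (λ X → (ι n ℚ.- ½) ℚ.* k² X) (λ X → (ℚ.- ι n) ℚ.* (ζ ⊥ (X ⊕ R) ℚ.* k² X)) ⟩
  ∑ (λ X → (ι n ℚ.- ½) ℚ.* k² X) ℚ.+ ∑ (λ X → (ℚ.- ι n) ℚ.* (ζ ⊥ (X ⊕ R) ℚ.* k² X))
    ≡⟨ cong₂ ℚ._+_ (∑-*ˡ (ι n ℚ.- ½) k²) (∑-*ˡ (ℚ.- ι n) λ X → ζ ⊥ (X ⊕ R) ℚ.* k² X) ⟩
  (ι n ℚ.- ½) ℚ.* ∑ k² ℚ.+ (ℚ.- ι n) ℚ.* ∑ (λ X → ζ ⊥ (X ⊕ R) ℚ.* k² X)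
    ≡⟨ cong₂ (λ a b → (ι n ℚ.- ½) ℚ.* a ℚ.+ (ℚ.- ι n) ℚ.* b) (∑-kernel² t R)
         (trans (∑-ζ⊥ k² R) (cong (λ b → b ℚ.* b) (trans (cong (kernel t) (∁R⊕R≡⊥ R)) (kernel-⊥ n t)))) ⟩
  (ι n ℚ.- ½) ℚ.* (2^ n ℚ.* ball n t) ℚ.+ (ℚ.- ι n) ℚ.* (ball n t ℚ.* ball n t)
    ≡⟨ cong ((ι n ℚ.- ½) ℚ.* (2^ n ℚ.* ball n t) ℚ.+_) (ℚ.neg-distribˡ-* (ι n) (ball n t ℚ.* ball n t)) ⟨
  (ι n ℚ.- ½) ℚ.* (2^ n ℚ.* ball n t) ℚ.- ι n ℚ.* (ball n t ℚ.* ball n t) ∎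
  where
  open ℚ.≤-Reasoning
  open +-*-Solver
  R : Subset n
  R = ⊥
  k² : Subset n → ℚ
  k² X = kernel t (X ⊕ R) ℚ.* kernel t (X ⊕ R)

f⊥≤∑f : ∀ {n} (f : Subset n → ℚ) → (∀ X → 0ℚ ℚ.≤ f X) → f ⊥ ℚ.≤ ∑ f
f⊥≤∑f {zero}  f 0≤f = ℚ.≤-refl
f⊥≤∑f {suc n} f 0≤f = subst (ℚ._≤ ∑ f) (ℚ.+-identityʳ (f ⊥))
  (ℚ.+-mono-≤ (f⊥≤∑f (f ∘ (outside ∷_)) (0≤f ∘ (outside ∷_)))
    (subst (ℚ._≤ ∑ (f ∘ (inside ∷_))) (∑-zero n) (∑-mono (0≤f ∘ (inside ∷_)))))

0<ball : ∀ n t → 0ℚ ℚ.< ball n t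
0<ball n t = ℚ.<-≤-trans (subst (0ℚ ℚ.<_) (sym deg≤-⊥) (ℚ.positive⁻¹ 1ℚ))
  (f⊥≤∑f {n} (deg≤ t) λ S → 0≤𝟙 (does (∣ S ∣ ℕ.≤? t)))
  where
  deg≤-⊥ : deg≤ t (⊥ {n}) ≡ 1ℚ
  deg≤-⊥ rewrite ∣⊥∣≡0 n = refl

-- The bound of `kernelEnergy≤` factors as B (n (N - B) - N/2), where B is positive and the
-- hypothesis makes the other factor negative.
kernelEnergy<0 : ∀ n t → ι n ℚ.* (2^ n ℚ.- ball n t) ℚ.< ½ ℚ.* 2^ n → kernelEnergy n t ℚ.< 0ℚ
kernelEnergy<0 n t h = ℚ.≤-<-trans (kernelEnergy≤ n t) (begin-strict
  (ι n ℚ.- ½) ℚ.* (N ℚ.* B) ℚ.- ι n ℚ.* (B ℚ.* B)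
    ≡⟨ solve 3 (λ n N B → (n :- con ½) :* (N :* B) :- n :* (B :* B)
                 := B :* (n :* (N :- B) :- con ½ :* N)) refl (ι n) N B ⟩
  B ℚ.* (ι n ℚ.* (N ℚ.- B) ℚ.- ½ ℚ.* N)
    <⟨ ℚ.*-monoʳ-<-pos B {{ℚ.positive (0<ball n t)}} (ℚ.+-monoˡ-< (ℚ.- (½ ℚ.* N)) h) ⟩
  B ℚ.* (½ ℚ.* N ℚ.- ½ ℚ.* N)
    ≡⟨ solve 2 (λ N B → B :* (con ½ :* N :- con ½ :* N) := con 0ℚ) refl N B ⟩
  0ℚ ∎)
  where
  open ℚ.≤-Reasoning
  open +-*-Solver
  N B : ℚ
  N = 2^ n
  B = ball n t

-- Counting sets of bounded size.

-- A set and its complement cannot both have size at most `t`, so the small sets and the complements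
-- of small sets are disjoint families.
2ball≤2^ : ∀ n t → t ℕ.+ t ℕ.< n → ball n t ℚ.+ ball n t ℚ.≤ 2^ n
2ball≤2^ n t 2t<n = begin
  ball n t ℚ.+ ball n t
    ≡⟨ cong (ball n t ℚ.+_) (∑-∁ {n} (deg≤ t)) ⟨
  ball n t ℚ.+ ∑ {n} (deg≤ t ∘ ∁)
    ≡⟨ ∑-+ {n} (deg≤ t) (deg≤ t ∘ ∁) ⟨
  ∑ {n} (λ S → deg≤ t S ℚ.+ deg≤ t (∁ S))
    ≤⟨ ∑-mono disjoint ⟩
  ∑ {n} (λ _ → 1ℚ)
    ≡⟨ ∑-one n ⟩
  2^ n ∎
  where
  open ℚ.≤-Reasoning
  disjoint : ∀ S → deg≤ t S ℚ.+ deg≤ t (∁ S) ℚ.≤ 1ℚ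
  disjoint S with ℕ.≤-<-connex ∣ S ∣ t
  ... | inj₂ t<∣S∣ = subst (ℚ._≤ 1ℚ)
    (sym (trans (cong (ℚ._+ deg≤ t (∁ S)) (deg≤-no {S = S} t<∣S∣)) (ℚ.+-identityˡ (deg≤ t (∁ S)))))
    (𝟙≤1 (does (∣ ∁ S ∣ ℕ.≤? t)))
  ... | inj₁ ∣S∣≤t = subst (ℚ._≤ 1ℚ)
    (sym (trans (cong (deg≤ t S ℚ.+_) (deg≤-no {S = ∁ S} t<∣∁S∣)) (ℚ.+-identityʳ (deg≤ t S))))
    (𝟙≤1 (does (∣ S ∣ ℕ.≤? t)))
    where
    t<∣∁S∣ : t ℕ.< ∣ ∁ S ∣
    t<∣∁S∣ = subst (t ℕ.<_) (sym (∣∁p∣≡n∸∣p∣ S))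
      (ℕ.m+n≤o⇒m≤o∸n (suc t) (ℕ.≤-trans (s≤s (ℕ.+-monoʳ-≤ t ∣S∣≤t)) 2t<n))

-- Induction along Pascal's rule, splitting on the first element; the step uses (n+1)^(m+1) +
-- (n+1)^m = (n+2)(n+1)^m.
∑-size<≤ : ∀ n m → ∑ {n} (λ S → 𝟙 (does (∣ S ∣ ℕ.<? m))) ℚ.≤ ι (suc n ℕ.^ m)
∑-size<≤ n       zero    = ℚ.≤-trans (ℚ.≤-reflexive (∑-zero n)) (0≤ι 1)
∑-size<≤ zero    (suc m) = ι-mono-≤ {1} {1 ℕ.^ suc m} (ℕ.m^n>0 1 (suc m))
∑-size<≤ (suc n) (suc m) = begin
  ∑ {n} (λ S → 𝟙 (does (∣ S ∣ ℕ.<? suc m))) ℚ.+ ∑ {n} (λ S → 𝟙 (does (∣ S ∣ ℕ.<? m)))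
    ≤⟨ ℚ.+-mono-≤ (∑-size<≤ n (suc m)) (∑-size<≤ n m) ⟩
  ι (suc n ℕ.^ suc m) ℚ.+ ι (suc n ℕ.^ m)
    ≡⟨ ι-+ (suc n ℕ.^ suc m) (suc n ℕ.^ m) ⟨
  ι (suc n ℕ.^ suc m ℕ.+ suc n ℕ.^ m)
    ≤⟨ ι-mono-≤ (ℕ.≤-trans
         (ℕ.≤-reflexive (ℕ.+-comm (suc n ℕ.^ suc m) (suc n ℕ.^ m)))
         (ℕ.*-monoʳ-≤ (suc (suc n)) (ℕ.^-monoˡ-≤ m (ℕ.n≤1+n (suc n))))) ⟩
  ι (suc (suc n) ℕ.^ suc m) ∎
  where open ℚ.≤-Reasoning

-- The difference counts the sets of size above `t`; their complements have size below n - t, hence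
-- below `m`.
2^-ball≤ : ∀ n t m → n ℕ.≤ t ℕ.+ m → 2^ n ℚ.- ball n t ℚ.≤ ι (suc n ℕ.^ m)
2^-ball≤ n t m n≤t+m = begin
  2^ n ℚ.- ball n t
    ≡⟨ cong₂ ℚ._-_ (∑-one n) (∑-∁ {n} (deg≤ t)) ⟨
  ∑ {n} (λ _ → 1ℚ) ℚ.- ∑ {n} (deg≤ t ∘ ∁)
    ≡⟨ cong (∑ {n} (λ _ → 1ℚ) ℚ.+_) (∑-neg {n} (deg≤ t ∘ ∁)) ⟨
  ∑ {n} (λ _ → 1ℚ) ℚ.+ ∑ {n} (λ S → ℚ.- deg≤ t (∁ S))
    ≡⟨ ∑-+ {n} (λ _ → 1ℚ) (λ S → ℚ.- deg≤ t (∁ S)) ⟨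
  ∑ {n} (λ S → 1ℚ ℚ.- deg≤ t (∁ S))
    ≤⟨ ∑-mono small ⟩
  ∑ {n} (λ S → 𝟙 (does (∣ S ∣ ℕ.<? m)))
    ≤⟨ ∑-size<≤ n m ⟩
  ι (suc n ℕ.^ m) ∎
  where
  open ℚ.≤-Reasoning
  small : ∀ S → 1ℚ ℚ.- deg≤ t (∁ S) ℚ.≤ 𝟙 (does (∣ S ∣ ℕ.<? m))
  small S with ℕ.<-≤-connex ∣ S ∣ m
  ... | inj₁ ∣S∣<m = subst (1ℚ ℚ.- deg≤ t (∁ S) ℚ.≤_) (sym (cong 𝟙 (dec-true (∣ S ∣ ℕ.<? m) ∣S∣<m)))
    (≤-by-difference (deg≤ t (∁ S)) (0≤𝟙 (does (∣ ∁ S ∣ ℕ.≤? t)))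
      (solve 2 (λ a b → a :- b :+ b := a) refl 1ℚ (deg≤ t (∁ S))))
    where open +-*-Solver
  ... | inj₂ m≤∣S∣ = subst (ℚ._≤ 𝟙 (does (∣ S ∣ ℕ.<? m)))
    (sym (trans (cong (λ q → 1ℚ ℚ.- q) (deg≤-yes {S = ∁ S} ∣∁S∣≤t)) (ℚ.+-inverseʳ 1ℚ)))
    (0≤𝟙 (does (∣ S ∣ ℕ.<? m)))
    where
    ∣∁S∣≤t : ∣ ∁ S ∣ ℕ.≤ t
    ∣∁S∣≤t = subst (ℕ._≤ t) (sym (∣∁p∣≡n∸∣p∣ S))
      (ℕ.m≤n+o⇒m∸n≤o n ∣ S ∣ (ℕ.≤-trans n≤t+m
        (subst (t ℕ.+ m ℕ.≤_) (ℕ.+-comm t ∣ S ∣) (ℕ.+-monoʳ-≤ t m≤∣S∣))))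

n<2^n : ∀ n → n ℕ.< 2 ℕ.^ n
n<2^n zero    = s≤s z≤n
n<2^n (suc n) = ℕ.+-mono-≤ (ℕ.m^n>0 2 n) (ℕ.≤-trans (n<2^n n) (ℕ.m≤m+n _ 0))

-- Since n + 1 ≤ (a+1)³ ≤ 2^(3a), the left side is at most 2 to the power 1 + 3a(a+1). For a ≥ 5
-- that exponent is below a³, hence below `n`.
2n[1+n]^a<2^n : ∀ n a → 5 ℕ.≤ a → a ℕ.^ 3 ℕ.≤ n → n ℕ.< suc a ℕ.^ 3 →
                2 ℕ.* (n ℕ.* suc n ℕ.^ a) ℕ.< 2 ℕ.^ n
2n[1+n]^a<2^n n a 5≤a a³≤n n<[1+a]³ = begin-strict
  2 ℕ.* (n ℕ.* suc n ℕ.^ a)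
    ≤⟨ ℕ.*-monoʳ-≤ 2 (ℕ.*-monoˡ-≤ (suc n ℕ.^ a) (ℕ.n≤1+n n)) ⟩
  2 ℕ.* suc n ℕ.^ suc a
    ≤⟨ ℕ.*-monoʳ-≤ 2 (ℕ.^-monoˡ-≤ (suc a) (ℕ.≤-trans n<[1+a]³ (ℕ.^-monoˡ-≤ 3 (n<2^n a)))) ⟩
  2 ℕ.* ((2 ℕ.^ a) ℕ.^ 3) ℕ.^ suc a
    ≡⟨ cong (2 ℕ.*_) (trans (cong (ℕ._^ suc a) (ℕ.^-*-assoc 2 a 3)) (ℕ.^-*-assoc 2 (a ℕ.* 3) (suc a))) ⟩
  2 ℕ.^ suc (a ℕ.* 3 ℕ.* suc a)
    <⟨ ℕ.^-monoʳ-< 2 (s≤s (s≤s z≤n)) (ℕ.<-≤-trans (cubic a 5≤a) a³≤n) ⟩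
  2 ℕ.^ n ∎
  where
  open ℕ.≤-Reasoning
  -- Substituting a = 5 + b leaves a remainder with nonnegative coefficients, which proves the cubic
  -- inequality.
  expand : ∀ b → let a = 5 ℕ.+ b in
           a ℕ.* (a ℕ.* (a ℕ.* 1)) ≡ suc (suc (a ℕ.* 3 ℕ.* suc a)) ℕ.+
             (33 ℕ.+ 42 ℕ.* b ℕ.+ 12 ℕ.* (b ℕ.* b) ℕ.+ b ℕ.* b ℕ.* b)
  expand = ℕSolver.solve-∀
  cubic : ∀ a → 5 ℕ.≤ a → suc (a ℕ.* 3 ℕ.* suc a) ℕ.< a ℕ.^ 3
  cubic a 5≤a with ℕ.m≤n⇒∃[o]m+o≡n 5≤a
  ... | b , refl = subst (suc (suc (a ℕ.* 3 ℕ.* suc a)) ℕ.≤_) (sym (expand b)) (ℕ.m≤m+n _ _)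

ball-large : ∀ n t a → 5 ℕ.≤ a → a ℕ.^ 3 ℕ.≤ n → n ℕ.< suc a ℕ.^ 3 → n ℕ.≤ t ℕ.+ a →
             ι n ℚ.* (2^ n ℚ.- ball n t) ℚ.< ½ ℚ.* 2^ n
ball-large n t a 5≤a a³≤n n<[1+a]³ n≤t+a = begin-strict
  ι n ℚ.* (2^ n ℚ.- ball n t)
    ≤⟨ ℚ.*-monoˡ-≤-nonNeg (ι n) {{ℚ.nonNegative (0≤ι n)}} (2^-ball≤ n t a n≤t+a) ⟩
  ι n ℚ.* ι (suc n ℕ.^ a)
    ≡⟨ ι-* n (suc n ℕ.^ a) ⟨
  ι M
    ≡⟨ solve 1 (λ q → q := con ½ :* (con (ι 2) :* q)) refl (ι M) ⟩
  ½ ℚ.* (ι 2 ℚ.* ι M)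
    ≡⟨ cong (½ ℚ.*_) (ι-* 2 M) ⟨
  ½ ℚ.* ι (2 ℕ.* M)
    <⟨ ℚ.*-monoʳ-<-pos ½ (ι-mono-< (2n[1+n]^a<2^n n a 5≤a a³≤n n<[1+a]³)) ⟩
  ½ ℚ.* 2^ n ∎
  where
  open ℚ.≤-Reasoning
  open +-*-Solver
  M : ℕ
  M = n ℕ.* suc n ℕ.^ a

-- Real inequalities from their rational approximations.

-- The approximations round down, so each of them, and not just the limit, is bounded by `b`.
rootSeq≤ : ∀ k .{{_ : ℕ.NonZero k}} n b m → n ℕ.≤ b ℕ.^ k → rootSeq k n m ℚ.≤ ι b
rootSeq≤ k n b m n≤b^k = /-mono a m b 0 (subst (ℕ._≤ b ℕ.* suc m) (sym (ℕ.*-identityʳ a))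
  (ℕ.≮⇒≥ λ lt → ℕ.<-irrefl refl (begin-strict
    a ℕ.^ k                ≤⟨ proj₁ (iroot-spec k (n ℕ.* suc m ℕ.^ k)) ⟩
    n ℕ.* suc m ℕ.^ k      ≤⟨ ℕ.*-monoˡ-≤ (suc m ℕ.^ k) n≤b^k ⟩
    b ℕ.^ k ℕ.* suc m ℕ.^ k ≡⟨ ^-distribʳ-* k b (suc m) ⟨
    (b ℕ.* suc m) ℕ.^ k    <⟨ ℕ.^-monoˡ-< k lt ⟩
    a ℕ.^ k                ∎)))
  where
  open ℕ.≤-Reasoning
  a : ℕ
  a = iroot k (n ℕ.* suc m ℕ.^ k)

≈-pointwise : ∀ {x y} → (∀ k → seq x k ≡ seq y k) → x ≈ y
≈-pointwise {x} {y} x≡y =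
    (λ ε 0<ε → 0 , λ k _ → p≤q+ε (ℚ.≤-reflexive (x≡y k)) (ℚ.<⇒≤ 0<ε))
  , (λ ε 0<ε → 0 , λ k _ → p≤q+ε (ℚ.≤-reflexive (sym (x≡y k))) (ℚ.<⇒≤ 0<ε))
  where
  p≤q+ε : ∀ {p q ε} → p ℚ.≤ q → 0ℚ ℚ.≤ ε → p ℚ.≤ q ℚ.+ ε
  p≤q+ε {p} p≤q 0≤ε = subst (ℚ._≤ _) (ℚ.+-identityʳ p) (ℚ.+-mono-≤ p≤q 0≤ε)

≤-pointwise : ∀ {x y} → (∀ k → seq x k ℚ.≤ seq y k) → x ≤ y
≤-pointwise {x} x≤y ε 0<ε = 0 , λ k _ →
  subst (ℚ._≤ _) (ℚ.+-identityʳ (seq x k)) (ℚ.+-mono-≤ (x≤y k) (ℚ.<⇒≤ 0<ε))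

+-mono-≤ : ∀ {x y u v} → x ≤ y → u ≤ v → x + u ≤ y + v
+-mono-≤ {x} {y} {u} {v} x≤y u≤v ε 0<ε =
  let M , f = x≤y (½ ℚ.* ε) (half>0 ε 0<ε)
      N , g = u≤v (½ ℚ.* ε) (half>0 ε 0<ε)
  in M ℕ.+ N , λ k l → begin
    seq x k ℚ.+ seq u k
      ≤⟨ ℚ.+-mono-≤ (f k (ℕ.≤-trans (ℕ.m≤m+n M N) l)) (g k (ℕ.≤-trans (ℕ.m≤n+m N M) l)) ⟩
    (seq y k ℚ.+ ½ ℚ.* ε) ℚ.+ (seq v k ℚ.+ ½ ℚ.* ε)
      ≡⟨ solve 3 (λ a b e → (a :+ con ½ :* e) :+ (b :+ con ½ :* e) := a :+ b :+ e) refl (seq y k) (seq v k) ε ⟩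
    seq y k ℚ.+ seq v k ℚ.+ ε ∎
  where
  open ℚ.≤-Reasoning
  open +-*-Solver

+-nonneg : ∀ {x y} → 0ℝ ≤ x → 0ℝ ≤ y → 0ℝ ≤ x + y
+-nonneg {x} {y} = +-mono-≤ {0ℝ} {x} {0ℝ} {y}

∑⊆-nonneg : ∀ {n} (f : Subset n → ℝ) → (∀ X → 0ℝ ≤ f X) → 0ℝ ≤ ∑⊆ f
∑⊆-nonneg {zero}  f 0≤f = 0≤f []
∑⊆-nonneg {suc n} f 0≤f = +-nonneg {∑⊆ (f ∘ (outside ∷_))} {∑⊆ (f ∘ (inside ∷_))}
  (∑⊆-nonneg (f ∘ (outside ∷_)) (0≤f ∘ (outside ∷_))) (∑⊆-nonneg (f ∘ (inside ∷_)) (0≤f ∘ (inside ∷_)))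

sum-nonpos : ∀ n (f : Fin n → ℝ) → (∀ i → f i ≤ 0ℝ) → sum f ≤ 0ℝ
sum-nonpos zero    f f≤0 = ≤-pointwise {0ℝ} {0ℝ} λ _ → ℚ.≤-refl
sum-nonpos (suc n) f f≤0 = +-mono-≤ {f Fin.zero} {0ℝ} {sum (f ∘ Fin.suc)} {0ℝ} (f≤0 Fin.zero)
  (sum-nonpos n (f ∘ Fin.suc) (f≤0 ∘ Fin.suc))

seq-∑⊆ : ∀ {n} (f : Subset n → ℝ) k → seq (∑⊆ f) k ≡ ∑ λ X → seq (f X) k
seq-∑⊆ {zero}  f k = refl
seq-∑⊆ {suc n} f k = cong₂ ℚ._+_ (seq-∑⊆ (f ∘ (outside ∷_)) k) (seq-∑⊆ (f ∘ (inside ∷_)) k)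

seq-when : ∀ {P : Set} (d : Dec P) x k → seq (when d λ _ → x) k ≡ 𝟙 (does d) ℚ.* seq x k
seq-when (yes _) x k = sym (ℚ.*-identityˡ (seq x k))
seq-when (no  _) x k = sym (ℚ.*-zeroˡ (seq x k))

seq-when-1 : ∀ {P : Set} (d : Dec P) k → seq (when d λ _ → 1ℝ) k ≡ 𝟙 (does d)
seq-when-1 (yes _) k = refl
seq-when-1 (no  _) k = refl

seq-when-*ˡ : ∀ {P : Set} (d : Dec P) x (f : P → ℝ) k →
              seq (when d λ p → x * f p) k ≡ seq x k ℚ.* seq (when d f) k
seq-when-*ˡ (yes _) x f k = refl
seq-when-*ˡ (no  _) x f k = sym (ℚ.*-zeroʳ (seq x k))

seq-when-no : ∀ {P : Set} (d : Dec P) (f : P → ℝ) k → ¬ P → seq (when d f) k ≡ 0ℚ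
seq-when-no (yes p) f k ¬p = contradiction p ¬p
seq-when-no (no _)  f k ¬p = refl

-- Quadratic forms of zeta matrices.

-- The coefficient vector v at the k-th approximation, extended by zero to all subsets.
coeffs : ∀ {q n} → (𝒫 q n → ℝ) → ℕ → Subset n → ℚ
coeffs {q} v k J = seq (when (∣ J ∣ ℕ.≤? q) λ p → v (J , p)) k

coeffs-degree : ∀ {q n} (v : 𝒫 q n → ℝ) k → HasDegree≤ q (coeffs v k)
coeffs-degree {q} v k J q<∣J∣ = seq-when-no (∣ J ∣ ℕ.≤? q) (λ p → v (J , p)) k (ℕ.<⇒≱ q<∣J∣)

gram : ∀ {n} → (Subset n → ℚ) → Subset n → Subset n → ℚ
gram W J J′ = ∑ λ X → W X ℚ.* (ζ X J ℚ.* ζ X J′)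

seq-zetaMatrix : ∀ q {n} (W : Subset n → ℝ) (J J′ : 𝒫 q n) k →
                 seq (zetaMatrix q W J J′) k ≡ gram (λ X → seq (W X) k) (proj₁ J) (proj₁ J′)
seq-zetaMatrix q W (J , _) (J′ , _) k = trans
  (seq-∑⊆ (λ X → W X * (when (J ⊆? X) (λ _ → 1ℝ) * when (J′ ⊆? X) (λ _ → 1ℝ))) k)
  (∑-cong λ X → cong (seq (W X) k ℚ.*_)
    (cong₂ ℚ._*_ (seq-when-1 (J ⊆? X) k) (seq-when-1 (J′ ⊆? X) k)))

gram-sym : ∀ {n} (W : Subset n → ℚ) J J′ → gram W J J′ ≡ gram W J′ J
gram-sym W J J′ = ∑-cong λ X → cong (W X ℚ.*_) (ℚ.*-comm (ζ X J) (ζ X J′))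

-- `eval w X` is the inner product of `w` with the zeta vector of `X`, so each rank-one term
-- contributes its weight times a square.
gram-form : ∀ {n} (W w : Subset n → ℚ) →
            ∑ (λ J → ∑ λ J′ → w J ℚ.* gram W J J′ ℚ.* w J′) ≡ ∑ (λ X → W X ℚ.* (eval w X ℚ.* eval w X))
gram-form W w = begin
  ∑ (λ J → ∑ λ J′ → w J ℚ.* gram W J J′ ℚ.* w J′)
    ≡⟨ ∑-cong (λ J → ∑-cong λ J′ → expand J J′) ⟩
  ∑ (λ J → ∑ λ J′ → ∑ λ X → T X J J′)
    ≡⟨ ∑-cong (λ J → ∑-swap (λ J′ X → T X J J′)) ⟩
  ∑ (λ J → ∑ λ X → ∑ λ J′ → T X J J′)
    ≡⟨ ∑-swap (λ J X → ∑ λ J′ → T X J J′) ⟩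
  ∑ (λ X → ∑ λ J → ∑ λ J′ → T X J J′)
    ≡⟨ ∑-cong (λ X → trans
         (∑-cong λ J → ∑-*ˡ (W X) (λ J′ → w J ℚ.* ζ X J ℚ.* (w J′ ℚ.* ζ X J′)))
         (trans (∑-*ˡ (W X) (λ J → ∑ λ J′ → w J ℚ.* ζ X J ℚ.* (w J′ ℚ.* ζ X J′)))
           (cong (W X ℚ.*_) (sym (∑-*-∑ (λ J → w J ℚ.* ζ X J) (λ J → w J ℚ.* ζ X J)))))) ⟩
  ∑ (λ X → W X ℚ.* (eval w X ℚ.* eval w X)) ∎
  where
  open ≡-Reasoning
  open +-*-Solver
  T : _ → _ → _ → ℚ
  T X J J′ = W X ℚ.* (w J ℚ.* ζ X J ℚ.* (w J′ ℚ.* ζ X J′))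
  expand : ∀ J J′ → w J ℚ.* gram W J J′ ℚ.* w J′ ≡ ∑ λ X → T X J J′
  expand J J′ = trans (cong (ℚ._* w J′) (sym (∑-*ˡ (w J) λ X → W X ℚ.* (ζ X J ℚ.* ζ X J′))))
    (trans (sym (∑-*ʳ (w J′) λ X → w J ℚ.* (W X ℚ.* (ζ X J ℚ.* ζ X J′))))
      (∑-cong λ X → solve 5 (λ a b W c d → a :* (W :* (c :* d)) :* b := W :* (a :* c :* (b :* d)))
        refl (w J) (w J′) (W X) (ζ X J) (ζ X J′)))

quadraticForm : ∀ q {n} → Matrix q n → (𝒫 q n → ℝ) → ℝ
quadraticForm q {n} M v = ∑𝒫 q n λ J → ∑𝒫 q n λ J′ → v J * M J J′ * v J′

-- Extending `v` by zero turns the two sums over `𝒫 q n` into sums over all subsets, to which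
-- `gram-form` applies.
seq-quadraticForm : ∀ q {n} (W : Subset n → ℝ) (v : 𝒫 q n → ℝ) k →
  seq (quadraticForm q (zetaMatrix q W) v) k ≡
  ∑ λ X → seq (W X) k ℚ.* (eval (coeffs v k) X ℚ.* eval (coeffs v k) X)
seq-quadraticForm q {n} W v k = trans
  (seq-∑⊆ (λ J → when (∣ J ∣ ℕ.≤? q) (λ p → row (J , p))) k)
  (trans (∑-cong λ J → outer J (∣ J ∣ ℕ.≤? q)) (gram-form (λ X → seq (W X) k) (coeffs v k)))
  where
  row : 𝒫 q n → ℝ
  row J = ∑𝒫 q n λ J′ → v J * zetaMatrix q W J J′ * v J′
  W′ : Subset n → ℚ
  W′ X = seq (W X) k
  seq-row : ∀ J → seq (row J) k ≡ ∑ λ J′ → seq (v J) k ℚ.* gram W′ (proj₁ J) J′ ℚ.* coeffs v k J′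
  seq-row J = trans
    (seq-∑⊆ (λ J′ → when (∣ J′ ∣ ℕ.≤? q) (λ p → v J * zetaMatrix q W J (J′ , p) * v (J′ , p))) k)
    (∑-cong λ J′ → inner J′ (∣ J′ ∣ ℕ.≤? q))
    where
    -- The decision is a variable, so that one match reduces `when` on both sides.
    inner : ∀ J′ (d : Dec (∣ J′ ∣ ℕ.≤ q)) →
            seq (when d λ p → v J * zetaMatrix q W J (J′ , p) * v (J′ , p)) k ≡
            seq (v J) k ℚ.* gram W′ (proj₁ J) J′ ℚ.* seq (when d λ p → v (J′ , p)) k
    inner J′ (yes p) = cong (λ m → seq (v J) k ℚ.* m ℚ.* seq (v (J′ , p)) k) (seq-zetaMatrix q W J (J′ , p) k)
    inner J′ (no  _) = sym (ℚ.*-zeroʳ (seq (v J) k ℚ.* gram W′ (proj₁ J) J′))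
  outer : ∀ J (d : Dec (∣ J ∣ ℕ.≤ q)) → seq (when d λ p → row (J , p)) k ≡
          ∑ λ J′ → seq (when d λ p → v (J , p)) k ℚ.* gram W′ J J′ ℚ.* coeffs v k J′
  outer J (yes p) = seq-row (J , p)
  outer J (no  _) = sym (trans
    (∑-cong λ J′ → trans (cong (ℚ._* coeffs v k J′) (ℚ.*-zeroˡ (gram W′ J J′))) (ℚ.*-zeroˡ (coeffs v k J′)))
    (∑-zero n))

-- Nonnegativity of every approximation suffices. At stage `k` both the weights and the test vector
-- are rational, and the test vector is an arbitrary polynomial of degree at most `q`.
zetaMatrix-PSD : ∀ q {n} (W : Subset n → ℝ) →
  (∀ k (w : Subset n → ℚ) → HasDegree≤ q w → 0ℚ ℚ.≤ ∑ λ X → seq (W X) k ℚ.* (eval w X ℚ.* eval w X)) →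
  PSD (zetaMatrix q W)
zetaMatrix-PSD q W h = record
  { symmetric = λ J J′ → ≈-pointwise {zetaMatrix q W J J′} {zetaMatrix q W J′ J} λ k →
      trans (seq-zetaMatrix q W J J′ k)
        (trans (gram-sym (λ X → seq (W X) k) (proj₁ J) (proj₁ J′)) (sym (seq-zetaMatrix q W J′ J k)))
  ; nonnegative = λ v → ≤-pointwise {0ℝ} {quadraticForm q (zetaMatrix q W) v} λ k →
      subst (0ℚ ℚ.≤_) (sym (seq-quadraticForm q W v k)) (h k (coeffs v k) (coeffs-degree v k))
  }

-- Values of the constraints at 0/1 points.

sumℚ : ∀ n → (Fin n → ℚ) → ℚ
sumℚ zero    f = 0ℚ
sumℚ (suc n) f = f Fin.zero ℚ.+ sumℚ n (f ∘ Fin.suc)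

seq-sum : ∀ n (f : Fin n → ℝ) {g : Fin n → ℚ} k → (∀ i → seq (f i) k ≡ g i) → seq (sum f) k ≡ sumℚ n g
seq-sum zero    f k f≡g = refl
seq-sum (suc n) f k f≡g = cong₂ ℚ._+_ (f≡g Fin.zero) (seq-sum n (f ∘ Fin.suc) k (f≡g ∘ Fin.suc))

mem : ∀ {n} → Subset n → Fin n → ℚ
mem X i = 𝟙 (does (i ∈? X))

-- Each coordinate contributes x_i inside `R` and 1 - x_i outside, which is 1 exactly where `X` and
-- `R` agree.
agreements : ∀ {n} (X R : Subset n) →
  sumℚ n (λ i → mem R i ℚ.* mem X i) ℚ.+ sumℚ n (λ i → mem (∁ R) i ℚ.* (1ℚ ℚ.- mem X i)) ≡ ι ∣ X ⊕ R ∣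
agreements []      []      = refl
agreements {suc n} (x ∷ X) (r ∷ R) = begin
  (a ℚ.+ s) ℚ.+ (b ℚ.+ u)   ≡⟨ solve 4 (λ a s b u → (a :+ s) :+ (b :+ u) := (a :+ b) :+ (s :+ u)) refl a s b u ⟩
  (a ℚ.+ b) ℚ.+ (s ℚ.+ u)   ≡⟨ cong ((a ℚ.+ b) ℚ.+_) (agreements X R) ⟩
  (a ℚ.+ b) ℚ.+ ι ∣ X ⊕ R ∣ ≡⟨ head x r ⟩
  ι ∣ (x ∷ X) ⊕ (r ∷ R) ∣   ∎
  where
  open ≡-Reasoning
  open +-*-Solver
  a b s u : ℚ
  a = mem (r ∷ R) Fin.zero ℚ.* mem (x ∷ X) Fin.zero
  b = mem (∁ (r ∷ R)) Fin.zero ℚ.* (1ℚ ℚ.- mem (x ∷ X) Fin.zero)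
  s = sumℚ n λ i → mem R i ℚ.* mem X i
  u = sumℚ n λ i → mem (∁ R) i ℚ.* (1ℚ ℚ.- mem X i)
  head : ∀ x r → mem (r ∷ R) Fin.zero ℚ.* mem (x ∷ X) Fin.zero ℚ.+
                 mem (∁ (r ∷ R)) Fin.zero ℚ.* (1ℚ ℚ.- mem (x ∷ X) Fin.zero) ℚ.+ ι ∣ X ⊕ R ∣ ≡
                 ι ∣ (x ∷ X) ⊕ (r ∷ R) ∣
  head outside outside = sym (ι-suc ∣ X ⊕ R ∣)
  head outside inside  = ℚ.+-identityˡ (ι ∣ X ⊕ R ∣)
  head inside  outside = ℚ.+-identityˡ (ι ∣ X ⊕ R ∣)
  head inside  inside  = sym (ι-suc ∣ X ⊕ R ∣)

seq-gK : ∀ {n} (R X : Subset n) k → seq (gK n R (point X)) k ≡ ι ∣ X ⊕ R ∣ ℚ.- ½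
seq-gK {n} R X k = cong (ℚ._- ½) (trans
  (cong₂ ℚ._+_
    (seq-sum n (λ r → when (r ∈? R) λ _ → point X r) k λ i →
      trans (seq-when (i ∈? R) (point X i) k) (cong (mem R i ℚ.*_) (seq-when-1 (i ∈? X) k)))
    (seq-sum n (λ r → when (r ∈? ∁ R) λ _ → 1ℝ - point X r) k λ i →
      trans (seq-when (i ∈? ∁ R) (1ℝ - point X i) k)
        (cong (λ q → mem (∁ R) i ℚ.* (1ℚ ℚ.- q)) (seq-when-1 (i ∈? X) k))))
  (agreements X R))

-- Nonempty and empty relaxations.

uniform-SoS : ∀ n t → t ℕ.+ t ℕ.< n → ∃ (SoS (gK n) t)
-- The weight `h` is 2⁻ⁿ, obtained as the solution of 2ⁿ h = 1.
uniform-SoS n t 2t<n with divide (2^ n) 1ℚ {{ℚ.positive (0<2^ n)}} (ℚ.positive⁻¹ 1ℚ)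
... | h , 0<h , 2^n*h≡1 = y , record
  { normalised    = ≈-pointwise {∑⊆ y} {1ℝ} λ k → trans (seq-∑⊆ y k) ∑h≡1
  ; psd           = zetaMatrix-PSD (suc t) y λ k w _ →
      subst (ℚ._≤ ∑ λ X → h ℚ.* (eval w X ℚ.* eval w X)) (∑-zero n) (∑-mono λ X → 0≤p*q (ℚ.<⇒≤ 0<h) (0≤p*p (eval w X)))
  ; psdConstraint = λ R → zetaMatrix-PSD t (λ I → gK n R (point I) * y I) λ k w degw →
      subst (0ℚ ℚ.≤_) (sym (factor R k w))
        (0≤p*q (ℚ.<⇒≤ 0<h) (weighted-square-nonneg t w degw (2ball≤2^ n t 2t<n) R))
  }
  where
  open +-*-Solver
  y : Subset n → ℝ
  y _ = fromℚ h
  ∑h≡1 : ∑ {n} (λ _ → h) ≡ 1ℚ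
  ∑h≡1 = trans (trans (∑-cong {n} λ _ → sym (ℚ.*-identityˡ h)) (∑-*ʳ {n} h λ _ → 1ℚ))
           (trans (cong (ℚ._* h) (∑-one n)) 2^n*h≡1)
  factor : ∀ R k (w : Subset n → ℚ) →
    ∑ (λ X → seq (gK n R (point X)) k ℚ.* h ℚ.* (eval w X ℚ.* eval w X)) ≡
    h ℚ.* ∑ (λ X → (ι ∣ X ⊕ R ∣ ℚ.- ½) ℚ.* (eval w X ℚ.* eval w X))
  factor R k w = trans
    (∑-cong λ X → trans (cong (λ g → g ℚ.* h ℚ.* (eval w X ℚ.* eval w X)) (seq-gK R X k))
      (solve 3 (λ a h b → a :* h :* b := h :* (a :* b)) refl
        (ι ∣ X ⊕ R ∣ ℚ.- ½) h (eval w X ℚ.* eval w X)))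
    (∑-*ˡ h λ X → (ι ∣ X ⊕ R ∣ ℚ.- ½) ℚ.* (eval w X ℚ.* eval w X))

-- Summing over R the constraint for g_R tested on the kernel centred at x_{∁ R} gives
-- kernelEnergy n t for every point I, so the total is kernelEnergy n t · ∑ I y_I.
no-SoS : ∀ n t → kernelEnergy n t ℚ.< 0ℚ → ∀ y → ¬ SoS (gK n) t y
no-SoS n t E<0 y S = ℚ.<-irrefl refl (begin-strict
  0ℚ
    ≤⟨ 0≤total ⟩
  seq total k ℚ.+ ε
    ≡⟨ cong (ℚ._+ ε) (seq-total k) ⟩
  s ℚ.* E ℚ.+ ε
    ≤⟨ ℚ.+-monoˡ-≤ ε (ℚ.*-monoʳ-≤-nonPos E {{ℚ.nonPositive (ℚ.<⇒≤ E<0)}} ½≤s) ⟩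
  ½ ℚ.* E ℚ.+ ε
    ≡⟨ solve 1 (λ e → con ½ :* e :+ con ½ :* (con ½ :* (:- e)) := con ½ :* (con ½ :* e)) refl E ⟩
  ½ ℚ.* (½ ℚ.* E)
    <⟨ ℚ.*-monoʳ-<-pos ½ (ℚ.*-monoʳ-<-pos ½ E<0) ⟩
  0ℚ ∎)
  where
  open ℚ.≤-Reasoning
  open +-*-Solver
  open SoS S
  E ε : ℚ
  E = kernelEnergy n t
  -- The mass is only known to be at least ½ at the chosen index, so the total is at most E/2 there.
  -- An error of -E/4 still leaves E/4 < 0.
  ε = ½ ℚ.* (½ ℚ.* (ℚ.- E))
  W : Subset n → Subset n → ℝ
  W R I = gK n R (point I) * y I
  test : Subset n → 𝒫 t n → ℝ
  test R (J , _) = fromℚ (coeff t R J)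
  form : Subset n → ℝ
  form R = quadraticForm t (zetaMatrix t (W R)) (test R)
  total : ℝ
  total = ∑⊆ form
  energyAt : Subset n → Subset n → ℚ
  energyAt I R = (ι ∣ I ⊕ R ∣ ℚ.- ½) ℚ.* (kernel t (I ⊕ R) ℚ.* kernel t (I ⊕ R))
  coeffs-test : ∀ R k J → coeffs (test R) k J ≡ coeff t R J
  coeffs-test R k J = go (∣ J ∣ ℕ.≤? t)
    where
    go : (d : Dec (∣ J ∣ ℕ.≤ t)) → seq (when d λ p → test R (J , p)) k ≡ coeff t R J
    go (yes _)     = refl
    go (no  ∣J∣≰t) = sym (coeff-degree t R J (ℕ.≰⇒> ∣J∣≰t))
  eval-test : ∀ R k X → eval (coeffs (test R) k) X ≡ kernel t (X ⊕ R)
  eval-test R k X = trans (∑-cong λ J → cong (ℚ._* ζ X J) (coeffs-test R k J)) (eval-coeff t R X)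
  seq-form : ∀ R k → seq (form R) k ≡ ∑ λ I → seq (y I) k ℚ.* energyAt I R
  seq-form R k = trans (seq-quadraticForm t (W R) (test R) k)
    (∑-cong λ I → trans
      (cong₂ (λ g e → g ℚ.* seq (y I) k ℚ.* (e ℚ.* e)) (seq-gK R I k) (eval-test R k I))
      (solve 3 (λ a h b → a :* h :* b := h :* (a :* b)) refl
        (ι ∣ I ⊕ R ∣ ℚ.- ½) (seq (y I) k) (kernel t (I ⊕ R) ℚ.* kernel t (I ⊕ R))))
  ∑-energyAt : ∀ I → ∑ (energyAt I) ≡ E
  ∑-energyAt I = trans
    (∑-cong λ R → cong (λ Z → (ι ∣ Z ∣ ℚ.- ½) ℚ.* (kernel t Z ℚ.* kernel t Z)) (⊕-comm I R))
    (∑-⊕ (λ Z → (ι ∣ Z ∣ ℚ.- ½) ℚ.* (kernel t Z ℚ.* kernel t Z)) I)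
  seq-total : ∀ k → seq total k ≡ seq (∑⊆ y) k ℚ.* E
  seq-total k = trans (seq-∑⊆ form k)
    (trans (∑-cong λ R → seq-form R k)
      (trans (∑-swap λ R I → seq (y I) k ℚ.* energyAt I R)
        (trans (∑-cong λ I → trans (∑-*ˡ (seq (y I) k) (energyAt I)) (cong (seq (y I) k ℚ.*_) (∑-energyAt I)))
          (trans (∑-*ʳ E λ I → seq (y I) k) (cong (ℚ._* E) (sym (seq-∑⊆ y k)))))))
  0<ε : 0ℚ ℚ.< ε
  0<ε = half>0 (½ ℚ.* (ℚ.- E)) (half>0 (ℚ.- E) (ℚ.neg-antimono-< E<0))
  total-bound : ∃ λ N → ∀ m → N ℕ.≤ m → 0ℚ ℚ.≤ seq total m ℚ.+ ε
  total-bound = ∑⊆-nonneg form (λ R → PSD.nonnegative (psdConstraint R) (test R)) ε 0<ε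
  mass-bound : ∃ λ N → ∀ m → N ℕ.≤ m → 1ℚ ℚ.≤ seq (∑⊆ y) m ℚ.+ ½
  mass-bound = proj₂ normalised ½ (ℚ.positive⁻¹ ½)
  k : ℕ
  k = proj₁ total-bound ℕ.+ proj₁ mass-bound
  s : ℚ
  s = seq (∑⊆ y) k
  0≤total : 0ℚ ℚ.≤ seq total k ℚ.+ ε
  0≤total = proj₂ total-bound k (ℕ.m≤m+n _ _)
  ½≤s : ½ ℚ.≤ s
  ½≤s = subst (½ ℚ.≤_) (solve 1 (λ s → s :+ con ½ :- con ½ := s) refl s)
    (ℚ.+-monoˡ-≤ (ℚ.- ½) (proj₂ mass-bound k (ℕ.m≤n+m (proj₁ mass-bound) (proj₁ total-bound))))

-- Emptiness of the integer hull and exactness.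

<⇒≱ : ∀ {p q} → p ℚ.< q → ¬ (q ℚ.≤ p)
<⇒≱ p<q q≤p = ℚ.<-irrefl refl (ℚ.<-≤-trans p<q q≤p)

-- `R` records which side each disjunction takes. This extracts the zeros of a 0/1 point without
-- deciding equality of reals.
separate : ∀ n {P Q : Fin n → Set} → (∀ i → P i ⊎ Q i) →
           ∃ λ R → (∀ {i} → i ∈ R → P i) × (∀ {i} → i ∉ R → Q i)
separate zero    h = [] , (λ {}) , λ {}
separate (suc n) h with h Fin.zero | separate n (h ∘ Fin.suc)
... | inj₁ p | R , f , g = inside ∷ R
  , (λ { here → p ; (there i∈R) → f i∈R })
  , (λ { {Fin.zero} 0∉ → contradiction here 0∉ ; {Fin.suc i} i∉ → g (i∉ ∘ there) })
... | inj₂ q | R , f , g = outside ∷ R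
  , (λ { (there i∈R) → f i∈R })
  , (λ { {Fin.zero} _ → q ; {Fin.suc i} i∉ → g (i∉ ∘ there) })

1-x≤0 : ∀ {x} → 1ℝ ≤ x → 1ℝ - x ≤ 0ℝ
1-x≤0 {x} 1≤x ε 0<ε = proj₁ (1≤x ε 0<ε) , λ k l → subst (1ℚ ℚ.- seq x k ℚ.≤_)
  (solve 2 (λ a e → a :+ e :- a := con 0ℚ :+ e) refl (seq x k) ε)
  (ℚ.+-monoˡ-≤ (ℚ.- seq x k) (proj₂ (1≤x ε 0<ε) k l))
  where open +-*-Solver

-- A 0/1 point violates the constraint of its own set of zeros.
infeasible : ∀ n x → ¬ Feasible (gK n) x
infeasible n x (binary , constraints) with separate n binary
... | R , zeros , ones = contradiction
  (ℚ.≤-trans (0≤g (M ℕ.+ N) (ℕ.m≤m+n M N))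
    (ℚ.+-monoˡ-≤ ε (ℚ.+-monoˡ-≤ (ℚ.- ½) (s≤0 (M ℕ.+ N) (ℕ.m≤n+m N M)))))
  (<⇒≱ (ℚ.negative⁻¹ (0ℚ ℚ.+ ε ℚ.- ½ ℚ.+ ε)))
  where
  ε : ℚ
  -- The error enters twice, from the constraint and from the sums; 2ε = ¼ stays below the ½
  -- subtracted in g_R.
  ε = ½ ℚ.* (½ ℚ.* ½)
  0<ε : 0ℚ ℚ.< ε
  0<ε = ℚ.positive⁻¹ ε
  f g : Fin n → ℝ
  f r = when (r ∈? R) λ _ → x r
  g r = when (r ∈? ∁ R) λ _ → 1ℝ - x r
  0≤0 : 0ℝ ≤ 0ℝ
  0≤0 = ≤-pointwise {0ℝ} {0ℝ} λ _ → ℚ.≤-refl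
  f≤0 : ∀ r → f r ≤ 0ℝ
  f≤0 r with r ∈? R
  ... | yes r∈R = proj₁ (zeros r∈R)
  ... | no  _   = 0≤0
  g≤0 : ∀ r → g r ≤ 0ℝ
  g≤0 r with r ∈? ∁ R
  ... | yes r∈∁R = 1-x≤0 {x r} (proj₂ (ones (x∈∁p⇒x∉p r∈∁R)))
  ... | no  _    = 0≤0
  sum≤0 : ∃ λ N → ∀ k → N ℕ.≤ k → seq (sum f + sum g) k ℚ.≤ 0ℚ ℚ.+ ε
  sum≤0 = +-mono-≤ {sum f} {0ℝ} {sum g} {0ℝ} (sum-nonpos n f f≤0) (sum-nonpos n g g≤0) ε 0<ε
  M N : ℕ
  M = proj₁ (constraints R ε 0<ε)
  N = proj₁ sum≤0
  0≤g = proj₂ (constraints R ε 0<ε)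
  s≤0 = proj₂ sum≤0

1≰0 : ¬ (1ℝ ≤ 0ℝ)
1≰0 1≤0 = contradiction (proj₂ (1≤0 ½ (ℚ.positive⁻¹ ½)) _ ℕ.≤-refl) (<⇒≱ {0ℚ ℚ.+ ½} (ℚ.*<* (ℤ.+<+ (s≤s (s≤s z≤n)))))

-- A combination of no points has total weight 0 instead of 1, and any other one supplies a feasible
-- point.
emptyHull : ∀ n x → ¬ ConvexHull (Feasible (gK n)) x
emptyHull n x (zero  , _ , _ , _ , _ , 0≈1 , _) = 1≰0 (proj₂ 0≈1)
emptyHull n x (suc m , p , _ , feasible , _)    = infeasible n (p Fin.zero) (feasible Fin.zero)

-- A vector in the relaxation has a projection, which exactness would place in the empty hull. With
-- `no-SoS⇒Exact`, exactness at round `t` amounts to emptiness of the relaxation.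
Exact⇒no-SoS : ∀ n t → Exact (gK n) t → ∀ y → ¬ SoS (gK n) t y
Exact⇒no-SoS n t (projection⊆hull , _) y S = emptyHull n x
  (projection⊆hull {x} (y , S , λ i → ≈-pointwise {x i} {x i} λ _ → refl))
  where
  x : Point n
  x i = ∑⊆ λ I → when (i ∈? I) λ _ → y I

no-SoS⇒Exact : ∀ n t → (∀ y → ¬ SoS (gK n) t y) → Exact (gK n) t
no-SoS⇒Exact n t none = (λ (y , S , _) → contradiction S (none y))
                      , (λ {x} hull → contradiction hull (emptyHull n x))

-- The rank and its bounds.

-- Strong induction on the witness, where excluded middle decides whether a smaller one exists.
least-element : ExcludedMiddle 0ℓ → (P : ℕ → Set) → ∀ m → P m →
                ∃ λ ρ → P ρ × ∀ t → P t → ρ ℕ.≤ t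
least-element em P = <-rec (λ m → P m → ∃ λ ρ → P ρ × ∀ t → P t → ρ ℕ.≤ t) step
  where
  step : ∀ m → (∀ {k} → k ℕ.< m → P k → ∃ λ ρ → P ρ × ∀ t → P t → ρ ℕ.≤ t) →
         P m → ∃ λ ρ → P ρ × ∀ t → P t → ρ ℕ.≤ t
  step m smaller Pm with em {∃ λ k → k ℕ.< m × P k}
  ... | yes (k , k<m , Pk) = smaller k<m Pk
  ... | no  none           = m , Pm , λ t Pt → ℕ.≮⇒≥ λ t<m → none (t , t<m , Pt)

½*2n≡n : ∀ n → ½ ℚ.* ι (2 ℕ.* n) ≡ ι n
½*2n≡n n = trans (cong (½ ℚ.*_) (ι-* 2 n))
  (solve 1 (λ q → con ½ :* (con (ι 2) :* q) := q) refl (ι n))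
  where open +-*-Solver

-- The source of the constant ½: integer bounds are only at hand up to a factor of 2 in the root.
half-root≤ : ∀ k .{{_ : ℕ.NonZero k}} n b m → n ℕ.≤ (2 ℕ.* b) ℕ.^ k → ½ ℚ.* rootSeq k n m ℚ.≤ ι b
half-root≤ k n b m n≤ = subst (½ ℚ.* rootSeq k n m ℚ.≤_) (½*2n≡n b)
  (ℚ.*-monoˡ-≤-nonNeg ½ (rootSeq≤ k n (2 ℕ.* b) m n≤))

m≤m^[1+k] : ∀ k m → m ℕ.≤ m ℕ.^ suc k
m≤m^[1+k] k zero      = z≤n
m≤m^[1+k] k m@(suc _) = ℕ.m≤m*n m (m ℕ.^ k) {{ℕ.m^n≢0 m k}}

-- The linear bound is weakened to a square root through n ≤ 2ρ ≤ (2ρ)².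
rank-lower : ∀ n ρ → n ℕ.≤ 2 ℕ.* ρ → ½ℝ * root 2 n ≤ fromℕ ρ
rank-lower n ρ n≤2ρ = ≤-pointwise {½ℝ * root 2 n} {fromℕ ρ} λ m →
  half-root≤ 2 n ρ m (ℕ.≤-trans n≤2ρ (m≤m^[1+k] 1 (2 ℕ.* ρ)))

-- From a ≥ 1 follows n < (a+1)³ ≤ (2a)³, so half the cube root of `n` is at most `a`, and `a` is at
-- most n - ρ.
rank-upper : ∀ n ρ a → 1 ℕ.≤ a → n ℕ.< suc a ℕ.^ 3 → ρ ℕ.+ a ℕ.≤ n →
             fromℕ ρ ≤ fromℕ n - ½ℝ * root 3 n
rank-upper n ρ a 1≤a n<[1+a]³ ρ+a≤n = ≤-pointwise {fromℕ ρ} {fromℕ n - ½ℝ * root 3 n} λ m → begin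
  ι ρ
    ≡⟨ solve 2 (λ r a → r := r :+ a :- a) refl (ι ρ) (ι a) ⟩
  ι ρ ℚ.+ ι a ℚ.- ι a
    ≡⟨ cong (ℚ._- ι a) (ι-+ ρ a) ⟨
  ι (ρ ℕ.+ a) ℚ.- ι a
    ≤⟨ ℚ.+-mono-≤ (ι-mono-≤ ρ+a≤n) (ℚ.neg-antimono-≤ (half-root≤ 3 n a m n≤[2a]³)) ⟩
  ι n ℚ.- ½ ℚ.* rootSeq 3 n m ∎
  where
  open ℚ.≤-Reasoning
  open +-*-Solver
  n≤[2a]³ : n ℕ.≤ (2 ℕ.* a) ℕ.^ 3
  n≤[2a]³ = ℕ.≤-trans (ℕ.<⇒≤ n<[1+a]³)
    (ℕ.^-monoˡ-≤ 3 (ℕ.+-mono-≤ 1≤a (ℕ.m≤m+n a 0)))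

-- 125 = 5³ is the threshold from which the integer cube root meets the bound required by
-- `ball-large`.
5≤iroot : ∀ n → 125 ℕ.≤ n → 5 ℕ.≤ iroot 3 n
5≤iroot n 125≤n = ℕ.≮⇒≥ λ a<5 → ℕ.<⇒≱ (proj₂ (iroot-spec 3 n))
  (ℕ.≤-trans (ℕ.^-monoˡ-≤ 3 a<5) 125≤n)

exact-upper : ∀ n → 125 ℕ.≤ n → Exact (gK n) (n ℕ.∸ iroot 3 n)
exact-upper n 125≤n = no-SoS⇒Exact n t (no-SoS n t (kernelEnergy<0 n t
  (ball-large n t a (5≤iroot n 125≤n) (proj₁ (iroot-spec 3 n)) (proj₂ (iroot-spec 3 n)) n≤t+a)))
  where
  a t : ℕ
  a = iroot 3 n
  t = n ℕ.∸ a
  n≤t+a : n ℕ.≤ t ℕ.+ a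
  n≤t+a = subst (n ℕ.≤_) (ℕ.+-comm a t) (ℕ.m≤n+m∸n n a)

exact-lower : ∀ n t → Exact (gK n) t → n ℕ.≤ 2 ℕ.* t
exact-lower n t exact = ℕ.≮⇒≥ λ 2t<n →
  let y , S = uniform-SoS n t (subst (ℕ._< n) (cong (t ℕ.+_) (ℕ.+-identityʳ t)) 2t<n)
  in Exact⇒no-SoS n t exact y S

rank-bounds : ExcludedMiddle 0ℓ → ∀ n → 125 ℕ.≤ n →
              ∃ λ ρ → IsSoSRank (gK n) ρ × n ℕ.≤ 2 ℕ.* ρ × ρ ℕ.+ iroot 3 n ℕ.≤ n
rank-bounds em n 125≤n =
  let ρ , exact , least = least-element em (Exact (gK n)) (n ℕ.∸ a) (exact-upper n 125≤n)
  in ρ , record { exact = exact ; least = least } , exact-lower n ρ exact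
   -- Minimality gives ρ ≤ n ∸ a; adding `a` back recovers `n`, as the truncated subtraction is
   -- exact for a ≤ n.
   , subst (ρ ℕ.+ a ℕ.≤_) (ℕ.m∸n+n≡m a≤n) (ℕ.+-monoˡ-≤ a (least (n ℕ.∸ a) (exact-upper n 125≤n)))
  where
  a : ℕ
  a = iroot 3 n
  a≤n : a ℕ.≤ n
  a≤n = ℕ.≤-trans (m≤m^[1+k] 2 a) (proj₁ (iroot-spec 3 n))

theorem9 : ExcludedMiddle 0ℓ →
    ∃[ c₁ ] ∃[ c₂ ] ∃[ n₀ ] 0ℝ < c₁ × 0ℝ < c₂ ×
    (∀ n → n₀ ℕ.≤ n →
    ∃[ ρ ] IsSoSRank (gK n) ρ ×
    c₁ * root 2 n ≤ fromℕ ρ ×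
    fromℕ ρ ≤ fromℕ n - c₂ * root 3 n)
theorem9 em = ½ℝ , ½ℝ , 125 , 0<½ , 0<½ , λ n 125≤n →
  let ρ , isRank , n≤2ρ , ρ+a≤n = rank-bounds em n 125≤n
  in ρ , isRank , rank-lower n ρ n≤2ρ
   , rank-upper n ρ (iroot 3 n) (ℕ.≤-trans (s≤s z≤n) (5≤iroot n 125≤n)) (proj₂ (iroot-spec 3 n)) ρ+a≤n
  where
  0<½ : 0ℝ < ½ℝ
  0<½ = ½ , ℚ.positive⁻¹ ½ , 0 , λ _ _ → ℚ.≤-refl
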